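{- Let $d\ge 1$ and let $G$ be a $d$-tree on $n\ge 2d+2$ vertices. Let $f:E(G)\to\{ -1,1\}$ be such that $\min\{e(-1),e(1)\}>\lfloor\frac{n-1}{2}\rfloor d-\binom{d+1}{2}$. Then $G$ contains a spanning tree $T$ with $|f(T)|\le 1$ (zero-sum or almost zero-sum). Moreover, the bound is sharp: for every $d$-tree $G$ on $n\ge 2d+2$ vertices there is a colouring $f:E(G)\to\{ -1,1\}$ with $\min\{e(-1),e(1)\}=\lfloor\frac{n-1}{2}\rfloor d-\binom{d+1}{2}$ such that no spanning tree $T$ of $G$ has $|f(T)|\le 1$.
   Context: A $d$-tree is a graph obtained from the complete graph $K_{d+1}$ by successively adding vertices, each new vertex being joined to exactly $d$ vertices of the graph constructed so far. For $f:E(G)\to\{ -1,1\}$ and a subgraph $H$, $f(H)=\sum_{e\in E(H)}f(e)$; $e(-1)$ and $e(1)$ denote the numbers of edges coloured $-1$ and $1$ respectively. -}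

module Defs where

open import Data.Nat using (ℕ; zero; suc; _+_; _*_; _∸_; _≤_; _<_; _⊔_; _⊓_)
open import Data.Nat.DivMod using (_/_)
open import Data.Nat.Combinatorics using (_C_)
open import Data.Integer using (ℤ; +_; -[1+_]; ∣_∣)
import Data.Integer as ℤ
open import Data.Sign using (Sign) renaming (_≟_ to _≟ˢ_)
open import Data.Fin using (Fin; zero; suc) renaming (_<_ to _<ᶠ_; _<?_ to _<ᶠ?_; _≟_ to _≟ᶠ_)
open import Data.Fin.Properties using (any?)
open import Data.List using (List; []; _∷_; _++_; [_]; length; filter; foldr; map; cartesianProduct; allFin)
open import Data.List.Relation.Unary.All using (All)
open import Data.List.Relation.Unary.Unique.Propositional using (Unique)
open import Data.List.Relation.Unary.Linked using (Linked)
open import Data.List.Membership.Propositional using (_∈_)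
import Data.List.Membership.DecPropositional as DecMem
open import Data.Product using (Σ; ∃; _×_; _,_; proj₁; proj₂)
open import Data.Sum using (_⊎_)
open import Data.Empty using (⊥)
open import Data.Unit using (⊤)
open import Relation.Nullary using (¬_; Dec; yes; no)
open import Relation.Nullary.Decidable using (_×-dec_; ¬?)
open import Relation.Binary.PropositionalEquality using (_≡_; _≢_)
open import Relation.Binary.Construct.Closure.ReflexiveTransitive using (Star)

------------------------------------------------------------------------
-- d-trees (labelled).  A d-tree on n vertices is built from K_{d+1}
-- by repeatedly adding a new vertex joined to exactly d distinct
-- vertices of the graph constructed so far.  Vertices are Fin n; the
-- newly added vertex gets label zero and old vertices are shifted by suc.

data DTree (d : ℕ) : ℕ → Set where
  base : DTree d (suc d)                                   -- K_{d+1}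
  add  : ∀ {n} (G : DTree d n) (S : List (Fin n)) →
         Unique S → length S ≡ d → DTree d (suc n)

-- adjacency in the d-tree
Adj : ∀ {d n} → DTree d n → Fin n → Fin n → Set
Adj base i j = i ≢ j
Adj (add G S _ _) zero    zero    = ⊥
Adj (add G S _ _) zero    (suc j) = j ∈ S
Adj (add G S _ _) (suc i) zero    = i ∈ S
Adj (add G S _ _) (suc i) (suc j) = Adj G i j

adj? : ∀ {d n} (G : DTree d n) (i j : Fin n) → Dec (Adj G i j)
adj? base i j = ¬? (i ≟ᶠ j)
adj? (add G S _ _) zero    zero    = no (λ ())
adj? (add G S _ _) zero    (suc j) = DecMem._∈?_ _≟ᶠ_ j S
adj? (add G S _ _) (suc i) zero    = DecMem._∈?_ _≟ᶠ_ i S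
adj? (add G S _ _) (suc i) (suc j) = adj? G i j

------------------------------------------------------------------------
-- Edges: an (unordered) edge {i,j} is represented by the pair (i , j)
-- with i < j.

IsEdge : ∀ {d n} → DTree d n → Fin n × Fin n → Set
IsEdge G (i , j) = (i <ᶠ j) × Adj G i j

isEdge? : ∀ {d n} (G : DTree d n) (p : Fin n × Fin n) → Dec (IsEdge G p)
isEdge? G (i , j) = (i <ᶠ? j) ×-dec adj? G i j

-- An edge colouring f : E(G) → {-1,1} is given by its values f i j on
-- the pairs i < j (values on other pairs are irrelevant).
Colouring : ℕ → Set
Colouring n = Fin n → Fin n → Sign

signVal : Sign → ℤ
signVal Sign.- = -[1+ 0 ]
signVal Sign.+ = + 1

allPairs : (n : ℕ) → List (Fin n × Fin n)
allPairs n = cartesianProduct (allFin n) (allFin n)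

-- e(σ): number of edges of G coloured σ
e : ∀ {d n} → DTree d n → Colouring n → Sign → ℕ
e {n = n} G f σ =
  length (filter (λ p → isEdge? G p ×-dec (f (proj₁ p) (proj₂ p) ≟ˢ σ)) (allPairs n))

------------------------------------------------------------------------
-- Subgraphs given by edge lists, spanning trees.

-- one step along an edge of the edge list T
Step : ∀ {n} → List (Fin n × Fin n) → Fin n → Fin n → Set
Step T u v = ((u , v) ∈ T) ⊎ ((v , u) ∈ T)

Connected : ∀ {n} → List (Fin n × Fin n) → Set
Connected {n} T = (u v : Fin n) → Star (Step T) u v

-- a cycle v ∷ ws (at least 3 distinct vertices, closing back to v)
Cycle : ∀ {n} → List (Fin n × Fin n) → Set
Cycle {n} T = Σ (Fin n) λ v → Σ (List (Fin n)) λ ws →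
  (2 ≤ length ws) × Unique (v ∷ ws) × Linked (Step T) (v ∷ ws ++ [ v ])

-- T is (the edge set of) a spanning tree of G: a set of edges of G
-- forming a connected acyclic graph on all vertices of G.
IsSpanningTree : ∀ {d n} → DTree d n → List (Fin n × Fin n) → Set
IsSpanningTree G T = All (IsEdge G) T × Unique T × Connected T × ¬ Cycle T

-- f(H) for the subgraph with edge list T
weight : ∀ {n} → Colouring n → List (Fin n × Fin n) → ℤ
weight f T = foldr ℤ._+_ (+ 0) (map (λ p → signVal (f (proj₁ p) (proj₂ p))) T)

-- ⌊(n-1)/2⌋ d − C(d+1,2)   (nonnegative whenever n ≥ 2d+2)
bound : ℕ → ℕ → ℕ
bound d n = ((n ∸ 1) / 2) * d ∸ (suc d C 2)

minCol : ∀ {d n} → DTree d n → Colouring n → ℕ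
minCol G f = e G f Sign.- ⊓ e G f Sign.+

HasGoodTree : ∀ {d n} → DTree d n → Colouring n → Set
HasGoodTree {n = n} G f =
  Σ (List (Fin n × Fin n)) λ T → IsSpanningTree G T × (∣ weight f T ∣ ≤ 1)

module Submission where

-- Order the vertices of a d-tree from newest to oldest (label zero is the newest one). Every vertex
-- has at most d older neighbours, and peeling off the newest vertex shows that a set of edges whose
-- spanning forest has m edges contains at most maxEdges d (m + 1) edges, maxEdges d s being the size
-- of a d-tree on s vertices. With N + 1 vertices and k = ⌊N/2⌋ ≥ d the bound of the theorem is
-- maxEdges d k, so each colour class of a colouring beating it spans a forest with at least k edges.
--
-- Run Kruskal's algorithm on A ++ P ++ B, where P is the +1 class and A ++ B the −1 class. It picks
-- a spanning tree whose +1 edges are those P adds to the forest of A: at least k of them when A is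
-- empty, at most N − k when A is the whole −1 class, and one more step along A changes this number
-- by at most one. A discrete intermediate value argument yields A for which both colours occur at
-- least k times among the N tree edges, so |f(T)| ≤ 1.
--
-- For sharpness colour −1 exactly the maxEdges d k edges among the k oldest vertices. These form a
-- graph in which the N + 1 − k newer vertices are isolated, so a spanning tree contains at most
-- k − 1 of them and hence at least N − k + 1 edges coloured +1.

open import Defs

open import Data.Empty using (⊥; ⊥-elim)
open import Data.Fin using (Fin; zero; suc; toℕ; fromℕ<) renaming (_<_ to _<ᶠ_; _≟_ to _≟ᶠ_)
import Data.Fin.Properties as Fin
open import Data.Integer using (∣_∣; _⊖_)
import Data.Integer as ℤ
open import Data.Integer.Properties using (distribʳ-⊖-+-pos; distribʳ-⊖-+-neg; +-cancelˡ-⊖; ⊖-≥)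
open import Data.List using (List; []; _∷_; _++_; [_]; length; filter; map; allFin; tabulate)
open import Data.List.Membership.Propositional using (_∈_; _∉_; lose)
open import Data.List.Membership.Propositional.Properties
  using (∈-filter⁺; ∈-filter⁻; ∈-++⁺ˡ; ∈-++⁺ʳ; ∈-++⁻; ∈-map⁺; ∈-map⁻; ∈-allFin; ∈-cartesianProduct⁺)
open import Data.List.Properties
  using ( ++-assoc; ++-identityʳ; length-++; length-map; length-tabulate; length-removeAt′; map-tabulate
        ; filter-all; filter-none; filter-++; filter-some; filter-notAll)
open import Data.List.Relation.Binary.Subset.Propositional using (_⊆_)
open import Data.List.Relation.Unary.All using (All; []; _∷_)
import Data.List.Relation.Unary.All as All
open import Data.List.Relation.Unary.All.Properties using (map⁺)
open import Data.List.Relation.Unary.AllPairs using ([]; _∷_)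
open import Data.List.Relation.Unary.Any using (Any; here; there; _─_)
import Data.List.Relation.Unary.Any as Any
open import Data.List.Relation.Unary.Linked using (Linked; []; [-]; _∷_)
import Data.List.Relation.Unary.Linked as Linked
open import Data.List.Relation.Unary.Unique.Propositional using (Unique)
import Data.List.Relation.Unary.Unique.Propositional.Properties as Unique
open import Data.Nat using (ℕ; zero; suc; _+_; _*_; _∸_; _≤_; _<_; _⊓_; z≤n; s≤s; _≤?_; _<?_)
open import Data.Nat.Combinatorics using (_C_; nCk+nC[k+1]≡[n+1]C[k+1]; nC1≡n)
open import Data.Nat.DivMod using (_/_; _%_; m≡m%n+[m/n]*n; m%n<n)
open import Data.Nat.Properties
open import Data.Nat.Tactic.RingSolver using (solve-∀)
open import Data.Product using (Σ; ∃; _×_; _,_; proj₁; proj₂; swap)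
import Data.Product as Product
open import Data.Product.Properties using (≡-dec)
open import Data.Sign using (Sign) renaming (_≟_ to _≟ˢ_)
open import Data.Sum using (_⊎_; inj₁; inj₂)
import Data.Sum as Sum
open import Function using (_∘_; id; case_of_)
open import Level using (0ℓ)
open import Relation.Binary.Construct.Closure.ReflexiveTransitive using (Star; ε; _◅_; _◅◅_; _⋆)
import Relation.Binary.Construct.Closure.ReflexiveTransitive as Star
open import Relation.Binary.Construct.Union using (_∪_)
open import Relation.Binary.Core using (Rel; _⇒_)
open import Relation.Binary.Definitions using (DecidableEquality; Symmetric)
open import Relation.Binary.PropositionalEquality
  using (_≡_; _≢_; refl; sym; trans; cong; cong₂; subst; module ≡-Reasoning)
open import Relation.Nullary using (¬_; Dec; yes; no)
open import Relation.Nullary.Decidable using (_×-dec_; ¬?)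
open import Relation.Unary using (Decidable)

-- Lists and counting

module _ {A : Set} where

  ∈-─ : ∀ {x y : A} {ys} (x∈ys : x ∈ ys) → y ∈ ys → y ≢ x → y ∈ (ys ─ x∈ys)
  ∈-─ (here refl) (here refl) y≢x = ⊥-elim (y≢x refl)
  ∈-─ (here refl) (there y∈ys) _  = y∈ys
  ∈-─ (there x∈ys) (here refl) _  = here refl
  ∈-─ (there x∈ys) (there y∈ys) y≢x = there (∈-─ x∈ys y∈ys y≢x)

  unique-⊆⇒length≤ : ∀ {xs ys : List A} → Unique xs → xs ⊆ ys → length xs ≤ length ys
  unique-⊆⇒length≤ {[]} _ _ = z≤n
  unique-⊆⇒length≤ {x ∷ xs} {ys} (x∉xs ∷ u) xs⊆ys = begin
    suc (length xs)          ≤⟨ s≤s (unique-⊆⇒length≤ u xs⊆ys─x) ⟩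
    suc (length (ys ─ x∈ys)) ≡⟨ sym (length-removeAt′ ys _) ⟩
    length ys                ∎
    where
    open ≤-Reasoning
    x∈ys = xs⊆ys (here refl)
    xs⊆ys─x : xs ⊆ (ys ─ x∈ys)
    xs⊆ys─x y∈xs = ∈-─ x∈ys (xs⊆ys (there y∈xs)) (λ y≡x → All.lookup x∉xs y∈xs (sym y≡x))

  map-unique : {B : Set} (f : A → B) {xs : List A} → Unique xs →
    (∀ {x y} → x ∈ xs → y ∈ xs → f x ≡ f y → x ≡ y) → Unique (map f xs)
  map-unique f {[]} _ _ = []
  map-unique f {x ∷ xs} (x∉xs ∷ u) inj =
    map⁺ (All.tabulate λ y∈xs fx≡fy → All.lookup x∉xs y∈xs (inj (here refl) (there y∈xs) fx≡fy))
    ∷ map-unique f u (λ p q → inj (there p) (there q))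

  ∉-middle : ∀ {x : A} Q {L} → Unique (Q ++ x ∷ L) → x ∉ Q
  ∉-middle (q ∷ Q) (q∉ ∷ _) (here refl) = All.lookup q∉ (∈-++⁺ʳ Q (here refl)) refl
  ∉-middle (q ∷ Q) (_ ∷ u) (there x∈Q) = ∉-middle Q u x∈Q

count : {A : Set} {P : A → Set} → Decidable P → List A → ℕ
count P? xs = length (filter P? xs)

module _ {A : Set} {P Q : A → Set} (P? : Decidable P) (Q? : Decidable Q) where

  count-mono : (∀ {x} → P x → Q x) → ∀ xs → count P? xs ≤ count Q? xs
  count-mono P⊆Q [] = z≤n
  count-mono P⊆Q (x ∷ xs) with P? x | Q? x
  ... | yes _  | yes _  = s≤s (count-mono P⊆Q xs)
  ... | yes px | no ¬qx = ⊥-elim (¬qx (P⊆Q px))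
  ... | no _   | yes _  = m≤n⇒m≤1+n (count-mono P⊆Q xs)
  ... | no _   | no _   = count-mono P⊆Q xs

  count-split : ∀ xs →
    count P? xs ≡ count (λ x → P? x ×-dec Q? x) xs + count (λ x → P? x ×-dec ¬? (Q? x)) xs
  count-split [] = refl
  count-split (x ∷ xs) with P? x | Q? x
  ... | yes _ | yes _ = cong suc (count-split xs)
  ... | yes _ | no _  = trans (cong suc (count-split xs)) (sym (+-suc _ _))
  ... | no _  | _     = count-split xs

count-cong : {A : Set} {P Q : A → Set} (P? : Decidable P) (Q? : Decidable Q) →
  (∀ {x} → P x → Q x) → (∀ {x} → Q x → P x) → ∀ xs → count P? xs ≡ count Q? xs
count-cong P? Q? P⊆Q Q⊆P xs = ≤-antisym (count-mono P? Q? P⊆Q xs) (count-mono Q? P? Q⊆P xs)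

module _ {A : Set} {P : A → Set} (P? : Decidable P) where

  count-++ : ∀ xs ys → count P? (xs ++ ys) ≡ count P? xs + count P? ys
  count-++ xs ys = trans (cong length (filter-++ P? xs ys)) (length-++ (filter P? xs))

  count-all : ∀ {xs} → All P xs → count P? xs ≡ length xs
  count-all all = cong length (filter-all P? all)

  count-none : ∀ {xs} → All (λ x → ¬ P x) xs → count P? xs ≡ 0
  count-none none = cong length (filter-none P? none)

  count-map : {B : Set} (f : B → A) → ∀ xs → count P? (map f xs) ≡ count (λ x → P? (f x)) xs
  count-map f [] = refl
  count-map f (x ∷ xs) with P? (f x)
  ... | yes _ = cong suc (count-map f xs)
  ... | no _  = count-map f xs

  count≤1 : ∀ {xs} → Unique xs → (∀ {x y} → P x → P y → x ≡ y) → count P? xs ≤ 1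
  count≤1 {xs} u P-unique with filter P? xs in eq
  ... | [] = z≤n
  ... | z ∷ zs = unique-⊆⇒length≤ (subst Unique eq (Unique.filter⁺ P? u)) ⊆[z]
    where
    ⊆[z] : z ∷ zs ⊆ [ z ]
    ⊆[z] w∈ = here (P-unique (satisfies w∈) (satisfies (here refl)))
      where
      satisfies : ∀ {w} → w ∈ z ∷ zs → P w
      satisfies w∈ = proj₂ (∈-filter⁻ P? {xs = xs} (subst (_ ∈_) (sym eq) w∈))

count-toℕ< : ∀ n t → t ≤ n → count (λ (x : Fin n) → toℕ x <? t) (allFin n) ≡ t
count-toℕ< n       zero    _         = count-none (λ (x : Fin n) → toℕ x <? 0) {allFin n} (All.tabulate λ _ ())
count-toℕ< (suc n) (suc t) (s≤s t≤n) = cong suc (begin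
  count below? (tabulate Fin.suc)       ≡⟨ cong (count below?) (sym (map-tabulate {n = n} id Fin.suc)) ⟩
  count below? (map Fin.suc (allFin n)) ≡⟨ count-map below? Fin.suc (allFin n) ⟩
  count (below? ∘ Fin.suc) (allFin n)   ≡⟨ count-cong (below? ∘ Fin.suc) (λ x → toℕ x <? t) ≤-pred s≤s (allFin n) ⟩
  count (λ x → toℕ x <? t) (allFin n)   ≡⟨ count-toℕ< n t t≤n ⟩
  t                                     ∎)
  where
  open ≡-Reasoning
  below? = λ (x : Fin (suc n)) → toℕ x <? suc t

module _ {A : Set} (_≟_ : DecidableEquality A) {P : A → Set} (P? : Decidable P) where

  count-∉ : ∀ {y xs} → All (_≢ y) xs → count P? xs ≡ count (λ x → P? x ×-dec ¬? (x ≟ y)) xs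
  count-∉ [] = refl
  count-∉ {y} {x ∷ xs} (x≢y ∷ xs≢y) with P? x | x ≟ y
  ... | _     | yes x≡y = ⊥-elim (x≢y x≡y)
  ... | yes _ | no _    = cong suc (count-∉ xs≢y)
  ... | no _  | no _    = count-∉ xs≢y

  count-remove : ∀ {y xs} → Unique xs → y ∈ xs → P y →
    count P? xs ≡ suc (count (λ x → P? x ×-dec ¬? (x ≟ y)) xs)
  count-remove {y} {x ∷ xs} (x∉xs ∷ u) (here refl) py with P? x | x ≟ x
  ... | no ¬py | _     = ⊥-elim (¬py py)
  ... | yes _  | no ¬e = ⊥-elim (¬e refl)
  ... | yes _  | yes _ = cong suc (count-∉ (All.map (λ x≢y y≡x → x≢y (sym y≡x)) x∉xs))
  count-remove {y} {x ∷ xs} (x∉xs ∷ u) (there y∈xs) py with P? x | x ≟ y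
  ... | _     | yes refl = ⊥-elim (All.lookup x∉xs y∈xs refl)
  ... | yes _ | no _     = cong suc (count-remove u y∈xs py)
  ... | no _  | no _     = count-remove u y∈xs py

-- Connected components and Kruskal's algorithm

Edge : ℕ → Set
Edge n = Fin n × Fin n

module _ {n : ℕ} where
  open import Algebra.Definitions {A = Fin n} _≡_ using (IdempotentFun)

  Step-mono : {L L′ : List (Edge n)} → L ⊆ L′ → Step L ⇒ Step L′
  Step-mono L⊆L′ = Sum.map L⊆L′ L⊆L′

  Step-sym : {L : List (Edge n)} → Symmetric (Step L)
  Step-sym = Sum.swap

  Step-++⁻ : (L : List (Edge n)) {L′ : List (Edge n)} → Step (L ++ L′) ⇒ Step L ∪ Step L′
  Step-++⁻ L (inj₁ p) = Sum.map inj₁ inj₁ (∈-++⁻ L p)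
  Step-++⁻ L (inj₂ p) = Sum.map inj₂ inj₂ (∈-++⁻ L p)

  record Labelling (c : Fin n → Fin n) (L : List (Edge n)) : Set where
    field
      idem     : IdempotentFun c
      sound    : ∀ {x y} → c x ≡ c y → Star (Step L) x y
      respects : ∀ {x y} → Step L x y → c x ≡ c y

    complete : ∀ {x y} → Star (Step L) x y → c x ≡ c y
    complete = Star.fold (λ x y → c x ≡ c y) (λ s e → trans (respects s) e) refl

  id-labelling : Labelling (λ x → x) []
  id-labelling = record
    { idem     = λ _ → refl
    ; sound    = λ { refl → ε }
    ; respects = λ { (inj₁ ()) ; (inj₂ ()) }
    }

  relabel : Fin n → Fin n → Fin n → Fin n
  relabel new old z with z ≟ᶠ old
  ... | yes _ = new
  ... | no _  = z

  relabel-old : ∀ new old → relabel new old old ≡ new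
  relabel-old new old with old ≟ᶠ old
  ... | yes _ = refl
  ... | no ¬e = ⊥-elim (¬e refl)

  relabel-other : ∀ new old z → z ≢ old → relabel new old z ≡ z
  relabel-other new old z z≢old with z ≟ᶠ old
  ... | yes e = ⊥-elim (z≢old e)
  ... | no _  = refl

  merge : (Fin n → Fin n) → Fin n → Fin n → Fin n → Fin n
  merge c a b x = relabel (c a) (c b) (c x)

  merge-idem : ∀ {c a b} → IdempotentFun c → c a ≢ c b → IdempotentFun (merge c a b)
  merge-idem {c} {a} {b} idem ca≢cb x with c x ≟ᶠ c b
  ... | yes _     = trans (cong (relabel (c a) (c b)) (idem a)) (relabel-other _ _ _ ca≢cb)
  ... | no cx≢cb  = trans (cong (relabel (c a) (c b)) (idem x)) (relabel-other _ _ _ cx≢cb)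

  merge-joins : ∀ c {a b} → c a ≢ c b → merge c a b a ≡ merge c a b b
  merge-joins c {a} {b} ca≢cb = trans (relabel-other _ _ _ ca≢cb) (sym (relabel-old (c a) (c b)))

  skip-labelling : ∀ {c Q a b} → Labelling c Q → c a ≡ c b → Labelling c (Q ++ [ (a , b) ])
  skip-labelling {c} {Q} lab ca≡cb = record
    { idem = idem ; sound = λ e → Star.map (Step-mono ∈-++⁺ˡ) (sound e) ; respects = respects′ }
    where
    open Labelling lab
    respects′ : ∀ {x y} → Step (Q ++ _) x y → c x ≡ c y
    respects′ s with Step-++⁻ Q s
    ... | inj₁ s′                  = respects s′
    ... | inj₂ (inj₁ (here refl)) = ca≡cb
    ... | inj₂ (inj₂ (here refl)) = sym ca≡cb

  merge-labelling : ∀ {c Q a b} → Labelling c Q → c a ≢ c b →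
    Labelling (merge c a b) (Q ++ [ (a , b) ])
  merge-labelling {c} {Q} {a} {b} lab ca≢cb = record
    { idem = merge-idem idem ca≢cb ; sound = sound′ ; respects = respects′ }
    where
    open Labelling lab
    Q′ = Q ++ [ (a , b) ]
    lift : ∀ {x y} → Star (Step Q) x y → Star (Step Q′) x y
    lift = Star.map (Step-mono ∈-++⁺ˡ)
    a→b : Step Q′ a b
    a→b = inj₁ (∈-++⁺ʳ Q (here refl))
    sound′ : ∀ {x y} → merge c a b x ≡ merge c a b y → Star (Step Q′) x y
    sound′ {x} {y} e with c x ≟ᶠ c b | c y ≟ᶠ c b
    ... | yes p | yes q = lift (sound (trans p (sym q)))
    ... | yes p | no _  = lift (sound p) ◅◅ (Step-sym a→b ◅ lift (sound e))
    ... | no _  | yes q = lift (sound e) ◅◅ (a→b ◅ lift (sound (sym q)))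
    ... | no _  | no _  = lift (sound e)
    respects′ : ∀ {x y} → Step Q′ x y → merge c a b x ≡ merge c a b y
    respects′ s with Step-++⁻ Q s
    ... | inj₁ s′                  = cong (relabel (c a) (c b)) (respects s′)
    ... | inj₂ (inj₁ (here refl)) = merge-joins c ca≢cb
    ... | inj₂ (inj₂ (here refl)) = sym (merge-joins c ca≢cb)

  mergeAll : (Fin n → Fin n) → List (Edge n) → Fin n → Fin n
  mergeAll c [] = c
  mergeAll c ((a , b) ∷ L) with c a ≟ᶠ c b
  ... | yes _ = mergeAll c L
  ... | no _  = mergeAll (merge c a b) L

  kruskalFrom : (Fin n → Fin n) → List (Edge n) → List (Edge n)
  kruskalFrom c [] = []
  kruskalFrom c ((a , b) ∷ L) with c a ≟ᶠ c b
  ... | yes _ = kruskalFrom c L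
  ... | no _  = (a , b) ∷ kruskalFrom (merge c a b) L

  mergeAll-labelling : ∀ {c Q} L → Labelling c Q → Labelling (mergeAll c L) (Q ++ L)
  mergeAll-labelling {Q = Q} [] lab = subst (Labelling _) (sym (++-identityʳ Q)) lab
  mergeAll-labelling {c} {Q} ((a , b) ∷ L) lab with c a ≟ᶠ c b
  ... | yes e = subst (Labelling _) (++-assoc Q _ L) (mergeAll-labelling L (skip-labelling lab e))
  ... | no ¬e = subst (Labelling _) (++-assoc Q _ L) (mergeAll-labelling L (merge-labelling lab ¬e))

  kruskalFrom-labelling : ∀ {c Q} L → Labelling c Q → Labelling (mergeAll c L) (Q ++ kruskalFrom c L)
  kruskalFrom-labelling {Q = Q} [] lab = subst (Labelling _) (sym (++-identityʳ Q)) lab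
  kruskalFrom-labelling {c} {Q} ((a , b) ∷ L) lab with c a ≟ᶠ c b
  ... | yes _ = kruskalFrom-labelling L lab
  ... | no ¬e = subst (Labelling _) (++-assoc Q _ _) (kruskalFrom-labelling L (merge-labelling lab ¬e))

  mergeAll-++ : ∀ c A B → mergeAll c (A ++ B) ≡ mergeAll (mergeAll c A) B
  mergeAll-++ c [] B = refl
  mergeAll-++ c ((a , b) ∷ A) B with c a ≟ᶠ c b
  ... | yes _ = mergeAll-++ c A B
  ... | no _  = mergeAll-++ (merge c a b) A B

  kruskalFrom-++ : ∀ c A B → kruskalFrom c (A ++ B) ≡ kruskalFrom c A ++ kruskalFrom (mergeAll c A) B
  kruskalFrom-++ c [] B = refl
  kruskalFrom-++ c ((a , b) ∷ A) B with c a ≟ᶠ c b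
  ... | yes _ = kruskalFrom-++ c A B
  ... | no _  = cong ((a , b) ∷_) (kruskalFrom-++ (merge c a b) A B)

  kruskalFrom-⊆ : ∀ c L → kruskalFrom c L ⊆ L
  kruskalFrom-⊆ c ((a , b) ∷ L) p with c a ≟ᶠ c b
  kruskalFrom-⊆ c ((a , b) ∷ L) p         | yes _ = there (kruskalFrom-⊆ c L p)
  kruskalFrom-⊆ c ((a , b) ∷ L) (here e)  | no _  = here e
  kruskalFrom-⊆ c ((a , b) ∷ L) (there p) | no _  = there (kruskalFrom-⊆ (merge c a b) L p)

  kruskalFrom-separates : ∀ c L {a b} → (a , b) ∈ kruskalFrom c L → c a ≢ c b
  kruskalFrom-separates c ((a , b) ∷ L) p with c a ≟ᶠ c b
  kruskalFrom-separates c ((a , b) ∷ L) p           | yes _ = kruskalFrom-separates c L p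
  kruskalFrom-separates c ((a , b) ∷ L) (here refl) | no ¬e = ¬e
  kruskalFrom-separates c ((a , b) ∷ L) (there p)   | no _  =
    λ e → kruskalFrom-separates (merge c a b) L p (cong (relabel (c a) (c b)) e)

  kruskalFrom-unique : ∀ c L → Unique (kruskalFrom c L)
  kruskalFrom-unique c [] = []
  kruskalFrom-unique c ((a , b) ∷ L) with c a ≟ᶠ c b
  ... | yes _ = kruskalFrom-unique c L
  ... | no ¬e =
    All.tabulate (λ p ab≡ → kruskalFrom-separates (merge c a b) L (subst (_∈ _) (sym ab≡) p) (merge-joins c ¬e))
    ∷ kruskalFrom-unique (merge c a b) L

  roots : (Fin n → Fin n) → ℕ
  roots c = count (λ x → c x ≟ᶠ x) (allFin n)

  roots-id : roots (λ x → x) ≡ n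
  roots-id = trans (count-all (λ x → x ≟ᶠ x) {allFin n} (All.tabulate (λ _ → refl)))
                   (length-tabulate {n = n} (λ x → x))

  roots-merge : ∀ {c a b} → IdempotentFun c → c a ≢ c b → roots c ≡ suc (roots (merge c a b))
  roots-merge {c} {a} {b} idem ca≢cb =
    trans (count-remove _≟ᶠ_ (λ x → c x ≟ᶠ x) (Unique.allFin⁺ n) (∈-allFin (c b)) (idem b))
          (cong suc (count-cong _ _ still-root new-root (allFin n)))
    where
    still-root : ∀ {x} → c x ≡ x × x ≢ c b → merge c a b x ≡ x
    still-root (cx≡x , x≢cb) = trans (relabel-other _ _ _ (λ e → x≢cb (trans (sym cx≡x) e))) cx≡x
    new-root : ∀ {x} → merge c a b x ≡ x → c x ≡ x × x ≢ c b
    new-root {x} e with c x ≟ᶠ c b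
    ... | yes cx≡cb = ⊥-elim (ca≢cb (trans (sym (trans (cong c (sym e)) (idem a))) cx≡cb))
    ... | no cx≢cb  = e , λ x≡cb → cx≢cb (trans (cong c x≡cb) (idem b))

  roots-mergeAll : ∀ {c} L → IdempotentFun c → roots c ≡ roots (mergeAll c L) + length (kruskalFrom c L)
  roots-mergeAll [] idem = sym (+-identityʳ _)
  roots-mergeAll {c} ((a , b) ∷ L) idem with c a ≟ᶠ c b
  ... | yes _ = roots-mergeAll L idem
  ... | no ¬e = trans (roots-merge idem ¬e)
                      (trans (cong suc (roots-mergeAll L (merge-idem idem ¬e))) (sym (+-suc _ _)))

  roots-mono : ∀ {c c′} → IdempotentFun c → IdempotentFun c′ →
    (∀ {x y} → c x ≡ c y → c′ x ≡ c′ y) → roots c′ ≤ roots c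
  roots-mono {c} {c′} idem idem′ finer = begin
    roots c′                 ≡⟨ sym (length-map c rs′) ⟩
    length (map c rs′)       ≤⟨ unique-⊆⇒length≤ (map-unique c (Unique.filter⁺ _ (Unique.allFin⁺ n)) injective) ⊆roots ⟩
    roots c                  ∎
    where
    open ≤-Reasoning
    rs′ = filter (λ x → c′ x ≟ᶠ x) (allFin n)
    root′ : ∀ {x} → x ∈ rs′ → c′ x ≡ x
    root′ p = proj₂ (∈-filter⁻ (λ x → c′ x ≟ᶠ x) {xs = allFin n} p)
    injective : ∀ {x y} → x ∈ rs′ → y ∈ rs′ → c x ≡ c y → x ≡ y
    injective p q e = trans (sym (root′ p)) (trans (finer e) (root′ q))
    ⊆roots : map c rs′ ⊆ filter (λ x → c x ≟ᶠ x) (allFin n)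
    ⊆roots p with ∈-map⁻ c p
    ... | x , _ , refl = ∈-filter⁺ (λ x → c x ≟ᶠ x) (∈-allFin (c x)) (idem x)

  label : List (Edge n) → Fin n → Fin n
  label = mergeAll (λ x → x)

  kruskal : List (Edge n) → List (Edge n)
  kruskal = kruskalFrom (λ x → x)

  #components : List (Edge n) → ℕ
  #components L = roots (label L)

  label-labelling : ∀ L → Labelling (label L) L
  label-labelling L = mergeAll-labelling L id-labelling

  kruskal-labelling : ∀ L → Labelling (label L) (kruskal L)
  kruskal-labelling L = kruskalFrom-labelling L id-labelling

  #components+length-kruskal : ∀ L → #components L + length (kruskal L) ≡ n
  #components+length-kruskal L = trans (sym (roots-mergeAll L (λ _ → refl))) roots-id

  length-kruskalFrom : ∀ c L → length (kruskalFrom c L) ≤ length L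
  length-kruskalFrom c L = unique-⊆⇒length≤ (kruskalFrom-unique c L) (kruskalFrom-⊆ c L)

  #components-mono : {L L′ : List (Edge n)} → Step L ⇒ Star (Step L′) →
    #components L′ ≤ #components L
  #components-mono {L} {L′} L⇒L′ =
    roots-mono (idem (label-labelling L)) (idem (label-labelling L′))
               (λ e → complete (label-labelling L′) ((L⇒L′ ⋆) (sound (label-labelling L) e)))
    where open Labelling

  #components-connected : {L : List (Edge n)} → Connected L → #components L ≤ 1
  #components-connected {L} conn =
    count≤1 (λ x → label L x ≟ᶠ x) (Unique.allFin⁺ n)
      (λ {x} {y} cx≡x cy≡y → trans (sym cx≡x) (trans (complete (conn x y)) cy≡y))
    where open Labelling (label-labelling L)

  kruskal-connected : {L : List (Edge n)} → Connected L → Connected (kruskal L)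
  kruskal-connected {L} conn u v =
    Labelling.sound (kruskal-labelling L) (Labelling.complete (label-labelling L) (conn u v))

  connected⇒length≥ : {L : List (Edge n)} → Connected L → n ≤ suc (length L)
  connected⇒length≥ {L} conn = begin
    n                                  ≡⟨ sym (#components+length-kruskal L) ⟩
    #components L + length (kruskal L) ≤⟨ +-mono-≤ (#components-connected conn)
                                                   (length-kruskalFrom _ L) ⟩
    suc (length L)                     ∎
    where open ≤-Reasoning

  roots+length-kruskal : ∀ {c} L → Labelling c L → roots c + length (kruskal L) ≡ n
  roots+length-kruskal {c} L lab =
    trans (cong (_+ length (kruskal L)) same-roots) (#components+length-kruskal L)
    where
    open Labelling
    same-roots : roots c ≡ #components L
    same-roots = ≤-antisym
      (roots-mono (idem (label-labelling L)) (idem lab) (λ e → complete lab (sound (label-labelling L) e)))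
      (roots-mono (idem lab) (idem (label-labelling L)) (λ e → complete (label-labelling L) (sound lab e)))

  length-kruskal-mono : {L L′ : List (Edge n)} → L ⊆ L′ → length (kruskal L) ≤ length (kruskal L′)
  length-kruskal-mono {L} {L′} L⊆L′ = +-cancelˡ-≤ (#components L′) _ _ (begin
    #components L′ + length (kruskal L) ≤⟨ +-monoˡ-≤ _ (#components-mono (Star.return ∘ Step-mono L⊆L′)) ⟩
    #components L + length (kruskal L)  ≡⟨ #components+length-kruskal L ⟩
    n                                   ≡⟨ sym (#components+length-kruskal L′) ⟩
    #components L′ + length (kruskal L′) ∎)
    where open ≤-Reasoning

  length-kruskal-++ : ∀ A B →
    length (kruskal (A ++ B)) ≡ length (kruskal A) + length (kruskalFrom (label A) B)
  length-kruskal-++ A B = trans (cong length (kruskalFrom-++ _ A B)) (length-++ (kruskal A))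

  length-kruskal-snoc : ∀ A e → length (kruskal (A ++ [ e ])) ≤ suc (length (kruskal A))
  length-kruskal-snoc A e = begin
    length (kruskal (A ++ [ e ]))                             ≡⟨ length-kruskal-++ A [ e ] ⟩
    length (kruskal A) + length (kruskalFrom (label A) [ e ]) ≤⟨ +-monoʳ-≤ _ (length-kruskalFrom (label A) [ e ]) ⟩
    length (kruskal A) + 1                                    ≡⟨ +-comm _ 1 ⟩
    suc (length (kruskal A))                                  ∎
    where open ≤-Reasoning

  length-kruskalFrom-snoc : ∀ A e P →
    length (kruskalFrom (label A) P) ≤ suc (length (kruskalFrom (label (A ++ [ e ])) P))
  length-kruskalFrom-snoc A e P = +-cancelˡ-≤ (length (kruskal A)) _ _ (begin
    length (kruskal A) + length (kruskalFrom (label A) P)   ≡⟨ sym (length-kruskal-++ A P) ⟩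
    length (kruskal (A ++ P))                               ≤⟨ length-kruskal-mono grow ⟩
    length (kruskal (A′ ++ P))                              ≡⟨ length-kruskal-++ A′ P ⟩
    length (kruskal A′) + length (kruskalFrom (label A′) P) ≤⟨ +-monoˡ-≤ _ (length-kruskal-snoc A e) ⟩
    suc (length (kruskal A)) + length (kruskalFrom (label A′) P) ≡⟨ sym (+-suc _ _) ⟩
    length (kruskal A) + suc (length (kruskalFrom (label A′) P)) ∎)
    where
    open ≤-Reasoning
    A′ = A ++ [ e ]
    grow : A ++ P ⊆ A′ ++ P
    grow p with ∈-++⁻ A p
    ... | inj₁ q = ∈-++⁺ˡ (∈-++⁺ˡ q)
    ... | inj₂ q = ∈-++⁺ʳ A′ q

  kruskal-keeps : ∀ T → (∀ Q a b L → Q ++ (a , b) ∷ L ≡ T → ¬ Star (Step Q) a b) →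
    kruskal T ≡ T
  kruskal-keeps T fresh = go [] T (λ x → x) id-labelling refl
    where
    go : ∀ Q L c → Labelling c Q → Q ++ L ≡ T → kruskalFrom c L ≡ L
    go Q [] c lab eq = refl
    go Q ((a , b) ∷ L) c lab eq with c a ≟ᶠ c b
    ... | yes e = ⊥-elim (fresh Q a b L eq (Labelling.sound lab e))
    ... | no ¬e = cong ((a , b) ∷_)
      (go (Q ++ [ (a , b) ]) L (merge c a b) (merge-labelling lab ¬e) (trans (++-assoc Q _ L) eq))

#components-pos : ∀ {n} (L : List (Edge (suc n))) → 1 ≤ #components L
#components-pos L =
  filter-some (λ x → label L x ≟ᶠ x) (lose (∈-allFin (label L zero)) (Labelling.idem (label-labelling L) zero))

length-kruskal-connected : ∀ {N} {L : List (Edge (suc N))} → Connected L → length (kruskal L) ≡ N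
length-kruskal-connected {N} {L} conn =
  suc-injective (trans (cong (_+ length (kruskal L)) (sym one-component)) (#components+length-kruskal L))
  where
  one-component : #components L ≡ 1
  one-component = ≤-antisym (#components-connected conn) (#components-pos L)

-- Cycles and forests

Ordered : ∀ {n} → List (Edge n) → Set
Ordered = All (λ p → proj₁ p <ᶠ proj₂ p)

module _ {n : ℕ} where

  isolated : ∀ {L : List (Edge n)} {x z} → (∀ {y} → ¬ Step L x y) → Star (Step L) x z → x ≡ z
  isolated _ ε = refl
  isolated no-step (s ◅ _) = ⊥-elim (no-step s)

  _≟ₑ_ : DecidableEquality (Edge n)
  _≟ₑ_ = ≡-dec _≟ᶠ_ _≟ᶠ_

  without : Fin n → Fin n → List (Edge n) → List (Edge n)
  without v w = filter (λ p → ¬? (p ≟ₑ (v , w)) ×-dec ¬? (p ≟ₑ (w , v)))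

  Step-without : ∀ {v w x y} {T : List (Edge n)} → Step T x y →
    (x , y) ≢ (v , w) → (x , y) ≢ (w , v) → Step (without v w T) x y
  Step-without (inj₁ p) ≢vw ≢wv = inj₁ (∈-filter⁺ _ p (≢vw , ≢wv))
  Step-without (inj₂ p) ≢vw ≢wv =
    inj₂ (∈-filter⁺ _ p ((λ e → ≢wv (cong swap e)) , (λ e → ≢vw (cong swap e))))

  cycle-redundant : ∀ {T : List (Edge n)} → Cycle T →
    ∃ λ v → ∃ λ w → Step T v w × Star (Step (without v w T)) w v
  cycle-redundant (v , [] , () , _)
  cycle-redundant (v , _ ∷ [] , s≤s () , _)
  cycle-redundant {T} (v , w ∷ z ∷ zs , _ , (v∉ ∷ w∉ ∷ _) , (v→w ∷ w→z ∷ rest)) =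
    v , w , v→w , Step-sym (leaving (≢v (there (here refl))) (≢w (here refl)) (Step-sym w→z))
                  ◅ chain zs (≢v (there (here refl))) (≢w (here refl))
                         (All.tabulate (λ u∈zs → ≢v (there (there u∈zs)) , ≢w (there u∈zs))) rest
    where
    ≢v : ∀ {u} → u ∈ w ∷ z ∷ zs → u ≢ v
    ≢v u∈ u≡v = All.lookup v∉ u∈ (sym u≡v)
    ≢w : ∀ {u} → u ∈ z ∷ zs → u ≢ w
    ≢w u∈ u≡w = All.lookup w∉ u∈ (sym u≡w)
    leaving : ∀ {x y} → x ≢ v → x ≢ w → Step T x y → Step (without v w T) x y
    leaving x≢v x≢w s = Step-without s (λ e → x≢v (cong proj₁ e)) (λ e → x≢w (cong proj₁ e))
    chain : ∀ {x} us → x ≢ v → x ≢ w → All (λ u → u ≢ v × u ≢ w) us →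
      Linked (Step T) (x ∷ us ++ [ v ]) → Star (Step (without v w T)) x v
    chain [] x≢v x≢w [] (s ∷ [-]) = leaving x≢v x≢w s ◅ ε
    chain (u ∷ us) x≢v x≢w ((u≢v , u≢w) ∷ us≢) (s ∷ l) =
      leaving x≢v x≢w s ◅ chain us u≢v u≢w us≢ l

  connected-short⇒acyclic : ∀ {T : List (Edge n)} → Connected T → length T < n → ¬ Cycle T
  connected-short⇒acyclic {T} conn short cyc with cycle-redundant cyc
  ... | v , w , v→w , w⇝v =
    <-irrefl refl (≤-trans short (≤-trans (connected⇒length≥ λ x y → (bypass ⋆) (conn x y)) shorter))
    where
    bypass : Step T ⇒ Star (Step (without v w T))
    bypass {x} {y} s with (x , y) ≟ₑ (v , w) | (x , y) ≟ₑ (w , v)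
    ... | yes refl | _        = Star.reverse Step-sym w⇝v
    ... | no _     | yes refl = w⇝v
    ... | no ≢vw   | no ≢wv   = Step-without s ≢vw ≢wv ◅ ε
    removed : Step T v w → Any (λ p → ¬ (p ≢ (v , w) × p ≢ (w , v))) T
    removed (inj₁ p) = Any.map (λ { refl (≢vw , _) → ≢vw refl }) p
    removed (inj₂ p) = Any.map (λ { refl (_ , ≢wv) → ≢wv refl }) p
    shorter : suc (length (without v w T)) ≤ length T
    shorter = filter-notAll _ T (removed v→w)

  Cycle-mono : ∀ {L L′ : List (Edge n)} → L ⊆ L′ → Cycle L → Cycle L′
  Cycle-mono L⊆L′ (v , ws , long , u , closed) = v , ws , long , u , Linked.map (Step-mono L⊆L′) closed

  open import Data.List.Membership.DecPropositional (_≟ᶠ_ {n}) using (_∈?_)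

  infixr 5 _▸_
  data Walk (R : Rel (Fin n) 0ℓ) : Fin n → Fin n → List (Fin n) → Set where
    end : ∀ {a} → Walk R a a []
    _▸_ : ∀ {a x b ws} → R a x → Walk R x b ws → Walk R a b (x ∷ ws)

  Star⇒simple-walk : ∀ {R a b} → Star R a b → ∃ λ ws → Walk R a b ws × Unique (a ∷ ws)
  Star⇒simple-walk ε = [] , end , [] ∷ []
  Star⇒simple-walk {a = a} (r ◅ rs) with Star⇒simple-walk rs
  ... | ws , walk , u with a ∈? (_ ∷ ws)
  ...   | yes a∈ = suffix walk a∈ u
    where
    suffix : ∀ {R x b ws} → Walk R x b ws → a ∈ x ∷ ws → Unique (x ∷ ws) →
      ∃ λ ws′ → Walk R a b ws′ × Unique (a ∷ ws′)
    suffix walk (here refl) u = _ , walk , u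
    suffix (_ ▸ walk) (there a∈) (_ ∷ u) = suffix walk a∈ u
  ...   | no a∉ = _ , r ▸ walk , All.tabulate (λ x∈ a≡x → a∉ (subst (_∈ _) (sym a≡x) x∈)) ∷ u

  walk+edge⇒cycle : ∀ {Q T : List (Edge n)} {a b ws} → Walk (Step Q) a b ws → Unique (a ∷ ws) →
    Q ⊆ T → (a , b) ∈ T → ¬ Step Q a b → a ≢ b → Cycle T
  walk+edge⇒cycle end _ _ _ _ a≢b = ⊥-elim (a≢b refl)
  walk+edge⇒cycle (s ▸ end) _ _ _ ¬s _ = ⊥-elim (¬s s)
  walk+edge⇒cycle {Q} {T} {a} {b} {x ∷ y ∷ ws} walk u Q⊆T ab∈T _ _ =
    a , x ∷ y ∷ ws , s≤s (s≤s z≤n) , u , closed walk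
    where
    closed : ∀ {c zs} → Walk (Step Q) c b zs → Linked (Step T) (c ∷ zs ++ [ a ])
    closed end = inj₂ ab∈T ∷ [-]
    closed (s ▸ walk) = Step-mono Q⊆T s ∷ closed walk

  acyclic⇒kruskal-keeps : ∀ {T : List (Edge n)} → Unique T → Ordered T → ¬ Cycle T → kruskal T ≡ T
  acyclic⇒kruskal-keeps {T} uT oT acyclic = kruskal-keeps T fresh
    where
    fresh : ∀ Q a b L → Q ++ (a , b) ∷ L ≡ T → ¬ Star (Step Q) a b
    fresh Q a b L eq a⇝b with Star⇒simple-walk a⇝b
    ... | ws , walk , u =
      acyclic (walk+edge⇒cycle walk u Q⊆T ab∈T ¬Step (λ e → <-irrefl (cong toℕ e) a<b))
      where
      Q⊆T : Q ⊆ T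
      Q⊆T p = subst (_ ∈_) eq (∈-++⁺ˡ p)
      ab∈T : (a , b) ∈ T
      ab∈T = subst (_ ∈_) eq (∈-++⁺ʳ Q (here refl))
      a<b : a <ᶠ b
      a<b = All.lookup oT ab∈T
      ¬Step : ¬ Step Q a b
      ¬Step (inj₁ p) = ∉-middle Q (subst Unique (sym eq) uT) p
      ¬Step (inj₂ p) = <-asym a<b (All.lookup oT (Q⊆T p))

  isolated-prefix⇒#components : ∀ {L : List (Edge n)} {t} → (∀ {x y} → Step L x y → t ≤ toℕ x) → t < n →
    suc t ≤ #components L
  -- The vertices below t are isolated, hence roots of their own, and the root of vertex t is one more.
  isolated-prefix⇒#components {L} {t} late t<n = begin
    suc t                                     ≡⟨ cong suc (sym (count-toℕ< n t (<⇒≤ t<n))) ⟩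
    suc (count (λ x → toℕ x <? t) (allFin n)) ≤⟨ s≤s (count-mono _ other-root? (λ x<t → own-root x<t , other-root x<t)
                                                                 (allFin n)) ⟩
    suc (count other-root? (allFin n))        ≡⟨ sym (count-remove _≟ᶠ_ root? (Unique.allFin⁺ n) (∈-allFin (c v)) (idem v)) ⟩
    #components L                             ∎
    where
    open ≤-Reasoning
    c = label L
    open Labelling (label-labelling L)
    v = fromℕ< t<n
    root? = λ x → c x ≟ᶠ x
    other-root? = λ x → root? x ×-dec ¬? (x ≟ᶠ c v)
    alone : ∀ {x} → toℕ x < t → ∀ {y} → ¬ Step L x y
    alone x<t s = <-irrefl refl (≤-trans x<t (late s))
    own-root : ∀ {x} → toℕ x < t → c x ≡ x
    own-root x<t = sym (isolated (alone x<t) (Star.reverse Step-sym (sound (idem _))))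
    other-root : ∀ {x} → toℕ x < t → x ≢ c v
    other-root {x} x<t x≡cv = <-irrefl (cong toℕ x≡v) (≤-trans x<t (≤-reflexive (sym (Fin.toℕ-fromℕ< t<n))))
      where
      x≡v : x ≡ v
      x≡v = isolated (alone x<t) (sound (trans (cong c x≡cv) (idem v)))

-- Edge sets with bounded forward degree

shift : ∀ {n} → Edge n → Edge (suc n)
shift (i , j) = suc i , suc j

liftLabel : ∀ {n} → (Fin n → Fin n) → Fin (suc n) → Fin (suc n)
liftLabel c zero    = zero
liftLabel c (suc i) = suc (c i)

roots-liftLabel : ∀ {n} (c : Fin n → Fin n) → roots (liftLabel c) ≡ suc (roots c)
roots-liftLabel {n} c = cong suc (begin
  count root? (tabulate Fin.suc)       ≡⟨ cong (count root?) (sym (map-tabulate {n = n} (λ x → x) Fin.suc)) ⟩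
  count root? (map Fin.suc (allFin n)) ≡⟨ count-map root? Fin.suc (allFin n) ⟩
  count (λ x → suc (c x) ≟ᶠ suc x) (allFin n) ≡⟨ count-cong _ _ Fin.suc-injective (cong suc) (allFin n) ⟩
  roots c                              ∎)
  where
  open ≡-Reasoning
  root? = λ (x : Fin (suc n)) → liftLabel c x ≟ᶠ x

module _ {n : ℕ} (X : List (Edge n)) where

  lift-labelling : ∀ {c} → Labelling c X → Labelling (liftLabel c) (map shift X)
  lift-labelling {c} lab = record { idem = idem′ ; sound = sound′ ; respects = respects′ }
    where
    open Labelling lab
    idem′ : ∀ x → liftLabel c (liftLabel c x) ≡ liftLabel c x
    idem′ zero    = refl
    idem′ (suc x) = cong suc (idem x)
    up : ∀ {x y} → Step X x y → Step (map shift X) (suc x) (suc y)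
    up = Sum.map (∈-map⁺ shift) (∈-map⁺ shift)
    sound′ : ∀ {x y} → liftLabel c x ≡ liftLabel c y → Star (Step (map shift X)) x y
    sound′ {zero}  {zero}  _ = ε
    sound′ {suc x} {suc y} e = Star.gmap suc up (sound (Fin.suc-injective e))
    respects′ : ∀ {x y} → Step (map shift X) x y → liftLabel c x ≡ liftLabel c y
    respects′ (inj₁ p) with ∈-map⁻ shift p
    ... | _ , q , refl = cong suc (respects (inj₁ q))
    respects′ (inj₂ p) with ∈-map⁻ shift p
    ... | _ , q , refl = cong suc (respects (inj₂ q))

  length-kruskal-shift : length (kruskal (map shift X)) ≡ length (kruskal X)
  length-kruskal-shift = +-cancelˡ-≡ (suc (#components X)) _ _ (begin
    suc (#components X) + length (kruskal (map shift X))
      ≡⟨ cong (_+ length (kruskal (map shift X))) (sym (roots-liftLabel (label X))) ⟩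
    roots (liftLabel (label X)) + length (kruskal (map shift X))
      ≡⟨ roots+length-kruskal (map shift X) (lift-labelling (label-labelling X)) ⟩
    suc n
      ≡⟨ cong suc (sym (#components+length-kruskal X)) ⟩
    suc (#components X) + length (kruskal X) ∎)
    where open ≡-Reasoning

  zero-isolated : ∀ {y} → ¬ Step (map shift X) zero y
  zero-isolated (inj₁ p) with ∈-map⁻ shift p
  ... | _ , _ , ()
  zero-isolated (inj₂ p) with ∈-map⁻ shift p
  ... | _ , _ , ()

forwardDegree : ∀ {n} → List (Edge n) → Fin n → ℕ
forwardDegree X i = count (λ p → proj₁ p ≟ᶠ i) X

module _ {n : ℕ} where

  withoutZero : List (Edge (suc n)) → List (Edge n)
  withoutZero []                     = []
  withoutZero ((zero  , _)     ∷ X) = withoutZero X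
  withoutZero ((suc i , zero)  ∷ X) = withoutZero X
  withoutZero ((suc i , suc j) ∷ X) = (i , j) ∷ withoutZero X

  atZero : List (Edge (suc n)) → List (Edge (suc n))
  atZero = filter (λ p → proj₁ p ≟ᶠ zero)

  length-withoutZero : ∀ X → Ordered X → length X ≡ length (withoutZero X) + length (atZero X)
  length-withoutZero [] [] = refl
  length-withoutZero ((zero , j) ∷ X) (_ ∷ o) = trans (cong suc (length-withoutZero X o)) (sym (+-suc _ _))
  length-withoutZero ((suc i , suc j) ∷ X) (_ ∷ o) = cong suc (length-withoutZero X o)

  ∈-withoutZero⁻ : ∀ {X i j} → (i , j) ∈ withoutZero X → (suc i , suc j) ∈ X
  ∈-withoutZero⁻ {(zero , _) ∷ X} p = there (∈-withoutZero⁻ p)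
  ∈-withoutZero⁻ {(suc _ , zero) ∷ X} p = there (∈-withoutZero⁻ p)
  ∈-withoutZero⁻ {(suc _ , suc _) ∷ X} (here refl) = here refl
  ∈-withoutZero⁻ {(suc _ , suc _) ∷ X} (there p) = there (∈-withoutZero⁻ p)

  ∈-withoutZero⁺ : ∀ {X i j} → (suc i , suc j) ∈ X → (i , j) ∈ withoutZero X
  ∈-withoutZero⁺ {(zero , _) ∷ X} (there p) = ∈-withoutZero⁺ p
  ∈-withoutZero⁺ {(suc _ , zero) ∷ X} (there p) = ∈-withoutZero⁺ p
  ∈-withoutZero⁺ {(suc _ , suc _) ∷ X} (here refl) = here refl
  ∈-withoutZero⁺ {(suc _ , suc _) ∷ X} (there p) = there (∈-withoutZero⁺ p)

  withoutZero-unique : ∀ {X} → Unique X → Unique (withoutZero X)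
  withoutZero-unique {[]} [] = []
  withoutZero-unique {(zero , _) ∷ X} (_ ∷ u) = withoutZero-unique u
  withoutZero-unique {(suc _ , zero) ∷ X} (_ ∷ u) = withoutZero-unique u
  withoutZero-unique {(suc _ , suc _) ∷ X} (x∉ ∷ u) =
    All.tabulate (λ p e → All.lookup x∉ (∈-withoutZero⁻ (subst (_∈ _) (sym e) p)) refl)
    ∷ withoutZero-unique u

  withoutZero-ordered : ∀ {X} → Ordered X → Ordered (withoutZero X)
  withoutZero-ordered {[]} [] = []
  withoutZero-ordered {(zero , _) ∷ X} (_ ∷ o) = withoutZero-ordered o
  withoutZero-ordered {(suc _ , zero) ∷ X} (_ ∷ o) = withoutZero-ordered o
  withoutZero-ordered {(suc _ , suc _) ∷ X} (s≤s i<j ∷ o) = i<j ∷ withoutZero-ordered o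

  forwardDegree-withoutZero : ∀ X i → forwardDegree (withoutZero X) i ≤ forwardDegree X (suc i)
  forwardDegree-withoutZero [] i = z≤n
  forwardDegree-withoutZero ((zero , _) ∷ X) i = forwardDegree-withoutZero X i
  forwardDegree-withoutZero ((suc i′ , zero) ∷ X) i with i′ ≟ᶠ i
  ... | yes _ = m≤n⇒m≤1+n (forwardDegree-withoutZero X i)
  ... | no _  = forwardDegree-withoutZero X i
  forwardDegree-withoutZero ((suc i′ , suc _) ∷ X) i with i′ ≟ᶠ i
  ... | yes _ = s≤s (forwardDegree-withoutZero X i)
  ... | no _  = forwardDegree-withoutZero X i

  ⊆-split : ∀ {X} → Ordered X → X ⊆ map shift (withoutZero X) ++ atZero X
  ⊆-split {X} o {zero , j} p = ∈-++⁺ʳ (map shift (withoutZero X)) (∈-filter⁺ _ p refl)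
  ⊆-split {X} o {suc i , zero} p with All.lookup o p
  ... | ()
  ⊆-split {X} o {suc i , suc j} p = ∈-++⁺ˡ (∈-map⁺ shift (∈-withoutZero⁺ p))

  split-⊆ : ∀ {X} → map shift (withoutZero X) ++ atZero X ⊆ X
  split-⊆ {X} p with ∈-++⁻ (map shift (withoutZero X)) p
  ... | inj₂ q = proj₁ (∈-filter⁻ _ {xs = X} q)
  ... | inj₁ q with ∈-map⁻ shift q
  ...   | _ , q′ , refl = ∈-withoutZero⁻ q′

  atZero-⊆ : ∀ X → atZero X ⊆ X
  atZero-⊆ X p = proj₁ (∈-filter⁻ _ {xs = X} p)

  atZero-starts-at-zero : ∀ X {p} → p ∈ atZero X → proj₁ p ≡ zero
  atZero-starts-at-zero X p = proj₂ (∈-filter⁻ _ {xs = X} p)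

  kruskal-atZero : ∀ {X} → Unique X → Ordered X → kruskal (atZero X) ≡ atZero X
  kruskal-atZero {X} u o = kruskal-keeps (atZero X) fresh
    where
    fresh : ∀ Q a b L → Q ++ (a , b) ∷ L ≡ atZero X → ¬ Star (Step Q) a b
    fresh Q a b L eq a⇝b = <-irrefl (cong toℕ (sym b≡a)) a<b
      where
      from-zero : ∀ {p} → p ∈ Q ++ (a , b) ∷ L → proj₁ p ≡ zero
      from-zero p = atZero-starts-at-zero X (subst (_ ∈_) eq p)
      a<b : a <ᶠ b
      a<b = All.lookup o (atZero-⊆ X (subst (_ ∈_) eq (∈-++⁺ʳ Q (here refl))))
      a≡0 = from-zero (∈-++⁺ʳ Q (here refl))
      b-isolated : ∀ {y} → ¬ Step Q b y
      b-isolated (inj₁ p) = <-irrefl (cong toℕ (trans a≡0 (sym (from-zero (∈-++⁺ˡ p))))) a<b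
      b-isolated (inj₂ p) with from-zero (∈-++⁺ˡ p)
      ... | refl = ∉-middle Q (subst Unique (sym eq) (Unique.filter⁺ _ u)) (subst (λ z → (z , b) ∈ Q) (sym a≡0) p)
      b≡a : b ≡ a
      b≡a = isolated b-isolated (Star.reverse Step-sym a⇝b)

  first-edge-accepted : ∀ {c} (X′ : List (Edge n)) → Labelling c (map shift X′) →
    ∀ Z → All (λ p → proj₁ p ≡ zero) Z → Ordered Z → 1 ≤ length Z →
    1 ≤ length (kruskalFrom c Z)
  first-edge-accepted {c} X′ lab ((a , b) ∷ Z) (refl ∷ _) (a<b ∷ _) _ with c zero ≟ᶠ c b
  ... | no _  = s≤s z≤n
  ... | yes e = ⊥-elim (<-irrefl (cong toℕ (isolated (zero-isolated X′) (Labelling.sound lab e))) a<b)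

module _ (d : ℕ) where

  -- The number of edges of a d-tree on s ≥ d + 1 vertices, and of K_s for s ≤ d + 1.
  maxEdges : ℕ → ℕ
  maxEdges zero    = 0
  maxEdges (suc s) = maxEdges s + s ⊓ d

  maxEdges-+ : ∀ s t → maxEdges s + t * (s ⊓ d) ≤ maxEdges (s + t)
  maxEdges-+ s zero = ≤-reflexive (trans (+-identityʳ _) (cong maxEdges (sym (+-identityʳ s))))
  maxEdges-+ s (suc t) = begin
    maxEdges s + (s ⊓ d + t * (s ⊓ d)) ≡⟨ cong (maxEdges s +_) (+-comm (s ⊓ d) _) ⟩
    maxEdges s + (t * (s ⊓ d) + s ⊓ d) ≡⟨ sym (+-assoc (maxEdges s) _ _) ⟩
    maxEdges s + t * (s ⊓ d) + s ⊓ d   ≤⟨ +-mono-≤ (maxEdges-+ s t) (⊓-monoˡ-≤ d (m≤m+n s t)) ⟩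
    maxEdges (s + t) + (s + t) ⊓ d     ≡⟨ cong maxEdges (sym (+-suc s t)) ⟩
    maxEdges (s + suc t)               ∎
    where open ≤-Reasoning

  maxEdges-mono : ∀ {s t} → s ≤ t → maxEdges s ≤ maxEdges t
  maxEdges-mono {s} {t} s≤t =
    ≤-trans (m≤m+n (maxEdges s) _)
            (≤-trans (maxEdges-+ s (t ∸ s)) (≤-reflexive (cong maxEdges (m+[n∸m]≡n s≤t))))

  maxEdges-step : ∀ r p q → p ≤ d → p ≤ r + q → (1 ≤ p → 1 ≤ q) →
    maxEdges (suc r) + p ≤ maxEdges (suc (r + q))
  maxEdges-step r zero q _ _ _ = ≤-trans (≤-reflexive (+-identityʳ _)) (maxEdges-mono (s≤s (m≤m+n r q)))
  maxEdges-step r (suc p) zero _ _ q≥1 with q≥1 (s≤s z≤n)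
  ... | ()
  maxEdges-step r (suc p) (suc q) p<d p<r+q _ =
    ≤-trans (+-monoʳ-≤ (maxEdges (suc r)) p≤) (maxEdges-+ (suc r) (suc q))
    where
    open ≤-Reasoning
    p≤ : suc p ≤ suc q * (suc r ⊓ d)
    p≤ with ≤-total d (suc r)
    ... | inj₁ d≤r = begin
      suc p              ≤⟨ p<d ⟩
      d                  ≤⟨ m≤m+n d (q * d) ⟩
      suc q * d          ≡⟨ cong (suc q *_) (sym (m≥n⇒m⊓n≡n d≤r)) ⟩
      suc q * (suc r ⊓ d) ∎
    ... | inj₂ r≤d = begin
      suc p              ≤⟨ p<r+q ⟩
      r + suc q          ≡⟨ +-suc r q ⟩
      suc (r + q)        ≤⟨ s≤s (+-monoʳ-≤ r (m≤m*n q (suc r))) ⟩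
      suc r + q * suc r  ≡⟨ cong (suc q *_) (sym (m≤n⇒m⊓n≡m r≤d)) ⟩
      suc q * (suc r ⊓ d) ∎

  length≤maxEdges : ∀ {n} (X : List (Edge n)) → Unique X → Ordered X → (∀ i → forwardDegree X i ≤ d) →
    length X ≤ maxEdges (suc (length (kruskal X)))
  length≤maxEdges {zero} [] _ _ _ = z≤n
  length≤maxEdges {zero} ((() , _) ∷ _) _ _ _
  length≤maxEdges {suc n} X u o deg = begin
    length X                                 ≡⟨ length-withoutZero X o ⟩
    length X′ + p                            ≤⟨ +-monoˡ-≤ p IH ⟩
    maxEdges (suc (length (kruskal X′))) + p ≤⟨ maxEdges-step _ p q (deg zero) p≤forest first-accepted ⟩
    maxEdges (suc (length (kruskal X′) + q)) ≡⟨ cong (λ m → maxEdges (suc m)) (sym forest-split) ⟩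
    maxEdges (suc (length (kruskal X)))      ∎
    where
    open ≤-Reasoning
    X′ = withoutZero X
    Z = atZero X
    p = length Z
    q = length (kruskalFrom (label (map shift X′)) Z)
    IH : length X′ ≤ maxEdges (suc (length (kruskal X′)))
    IH = length≤maxEdges X′ (withoutZero-unique u) (withoutZero-ordered o)
           (λ i → ≤-trans (forwardDegree-withoutZero X i) (deg (suc i)))
    forest-split : length (kruskal X) ≡ length (kruskal X′) + q
    forest-split = begin-equality
      length (kruskal X)                      ≡⟨ ≤-antisym (length-kruskal-mono (⊆-split o))
                                                           (length-kruskal-mono (split-⊆ {X = X})) ⟩
      length (kruskal (map shift X′ ++ Z))    ≡⟨ length-kruskal-++ (map shift X′) Z ⟩
      length (kruskal (map shift X′)) + q     ≡⟨ cong (_+ q) (length-kruskal-shift X′) ⟩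
      length (kruskal X′) + q                 ∎
    p≤forest : p ≤ length (kruskal X′) + q
    p≤forest = begin
      p                   ≡⟨ cong length (sym (kruskal-atZero u o)) ⟩
      length (kruskal Z)  ≤⟨ length-kruskal-mono (atZero-⊆ X) ⟩
      length (kruskal X)  ≡⟨ forest-split ⟩
      length (kruskal X′) + q ∎
    first-accepted : 1 ≤ p → 1 ≤ q
    first-accepted = first-edge-accepted X′ (label-labelling (map shift X′)) Z
      (All.tabulate (atZero-starts-at-zero X)) (All.tabulate (λ p → All.lookup o (atZero-⊆ X p)))

-- Edges of d-trees

C2-suc : ∀ m → suc m C 2 ≡ m + m C 2
C2-suc m = trans (sym (nCk+nC[k+1]≡[n+1]C[k+1] m 1)) (cong (_+ m C 2) (nC1≡n m))

C2-double : ∀ m → m C 2 + m C 2 + m ≡ m * m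
C2-double zero    = refl
C2-double (suc m) = begin
  suc m C 2 + suc m C 2 + suc m     ≡⟨ cong (λ c → c + c + suc m) (C2-suc m) ⟩
  m + m C 2 + (m + m C 2) + suc m   ≡⟨ rearrange m (m C 2) ⟩
  m C 2 + m C 2 + m + (m + suc m)   ≡⟨ cong (_+ (m + suc m)) (C2-double m) ⟩
  m * m + (m + suc m)               ≡⟨ square m ⟩
  suc m * suc m                     ∎
  where
  open ≡-Reasoning
  rearrange : ∀ m c → m + c + (m + c) + suc m ≡ c + c + m + (m + suc m)
  rearrange = solve-∀
  square : ∀ m → m * m + (m + suc m) ≡ suc m * suc m
  square = solve-∀

module _ (d : ℕ) where

  maxEdges-complete : ∀ s → s ≤ suc d → maxEdges d s ≡ s C 2
  maxEdges-complete zero _ = refl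
  maxEdges-complete (suc s) (s≤s s≤d) = begin
    maxEdges d s + s ⊓ d ≡⟨ cong₂ _+_ (maxEdges-complete s (m≤n⇒m≤1+n s≤d)) (m≤n⇒m⊓n≡m s≤d) ⟩
    s C 2 + s            ≡⟨ +-comm (s C 2) s ⟩
    s + s C 2            ≡⟨ sym (C2-suc s) ⟩
    suc s C 2            ∎
    where open ≡-Reasoning

toZero : ∀ {n} → Fin n → Edge (suc n)
toZero s = zero , suc s

extend : ∀ {n} → List (Fin n) → List (Edge n) → List (Edge (suc n))
extend S E = map toZero S ++ map shift E

module _ {n : ℕ} (S : List (Fin n)) (E : List (Edge n)) where

  length-extend : length (extend S E) ≡ length S + length E
  length-extend = trans (length-++ (map toZero S)) (cong₂ _+_ (length-map toZero S) (length-map shift E))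

  ∈-extend⁻ : ∀ {p} → p ∈ extend S E →
    (∃ λ s → s ∈ S × p ≡ toZero s) ⊎ (∃ λ q → q ∈ E × p ≡ shift q)
  ∈-extend⁻ p∈ = Sum.map (∈-map⁻ toZero) (∈-map⁻ shift) (∈-++⁻ (map toZero S) p∈)

  ∈-extend⁺ˡ : ∀ {s} → s ∈ S → (zero , suc s) ∈ extend S E
  ∈-extend⁺ˡ s∈ = ∈-++⁺ˡ (∈-map⁺ toZero s∈)

  ∈-extend⁺ʳ : ∀ {q} → q ∈ E → shift q ∈ extend S E
  ∈-extend⁺ʳ q∈ = ∈-++⁺ʳ (map toZero S) (∈-map⁺ shift q∈)

  extend-unique : Unique S → Unique E → Unique (extend S E)
  extend-unique uS uE =
    Unique.++⁺ (Unique.map⁺ (λ { refl → refl }) uS) (Unique.map⁺ (λ { refl → refl }) uE) disjoint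
    where
    disjoint : ∀ {p} → p ∈ map toZero S × p ∈ map shift E → ⊥
    disjoint (p∈S , p∈E) with ∈-map⁻ toZero p∈S | ∈-map⁻ shift p∈E
    ... | _ , _ , refl | _ , _ , ()

  forwardDegree-extend-zero : forwardDegree (extend S E) zero ≡ length S
  forwardDegree-extend-zero = begin
    count P? (map toZero S ++ map shift E)           ≡⟨ count-++ P? (map toZero S) (map shift E) ⟩
    count P? (map toZero S) + count P? (map shift E) ≡⟨ cong₂ _+_ (count-all P? starts-at-zero)
                                                                  (count-none P? starts-later) ⟩
    length (map toZero S) + 0                        ≡⟨ trans (+-identityʳ _) (length-map toZero S) ⟩
    length S                                         ∎
    where
    open ≡-Reasoning
    P? = λ (p : Edge (suc n)) → proj₁ p ≟ᶠ zero
    starts-at-zero : All (λ p → proj₁ p ≡ zero) (map toZero S)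
    starts-at-zero = map⁺ (All.tabulate λ _ → refl)
    starts-later : All (λ p → proj₁ p ≢ zero) (map shift E)
    starts-later = map⁺ (All.tabulate λ _ ())

  forwardDegree-extend-suc : ∀ i → forwardDegree (extend S E) (suc i) ≡ forwardDegree E i
  forwardDegree-extend-suc i = begin
    count P? (map toZero S ++ map shift E)           ≡⟨ count-++ P? (map toZero S) (map shift E) ⟩
    count P? (map toZero S) + count P? (map shift E) ≡⟨ cong (_+ count P? (map shift E)) (count-none P? not-at-i) ⟩
    count P? (map shift E)                           ≡⟨ count-map P? shift E ⟩
    count (λ p → suc (proj₁ p) ≟ᶠ suc i) E           ≡⟨ count-cong _ _ Fin.suc-injective (cong suc) E ⟩
    forwardDegree E i                                ∎
    where
    open ≡-Reasoning
    P? = λ (p : Edge (suc n)) → proj₁ p ≟ᶠ suc i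
    not-at-i : All (λ p → proj₁ p ≢ suc i) (map toZero S)
    not-at-i = map⁺ (All.tabulate λ _ ())

completeEdges : (m t : ℕ) → List (Edge m)
completeEdges zero    t       = []
completeEdges (suc m) zero    = extend (allFin m) (completeEdges m zero)
completeEdges (suc m) (suc t) = map shift (completeEdges m t)

length-completeEdges : ∀ m t → length (completeEdges m t) ≡ (m ∸ t) C 2
length-completeEdges zero    zero    = refl
length-completeEdges zero    (suc t) = refl
length-completeEdges (suc m) zero    = begin
  length (extend (allFin m) (completeEdges m zero)) ≡⟨ length-extend (allFin m) _ ⟩
  length (allFin m) + length (completeEdges m zero) ≡⟨ cong₂ _+_ (length-tabulate {n = m} (λ x → x))
                                                               (length-completeEdges m zero) ⟩
  m + m C 2                                        ≡⟨ sym (C2-suc m) ⟩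
  suc m C 2                                        ∎
  where open ≡-Reasoning
length-completeEdges (suc m) (suc t) = trans (length-map shift (completeEdges m t)) (length-completeEdges m t)

∈-completeEdges⁻ : ∀ {m t p} → p ∈ completeEdges m t → proj₁ p <ᶠ proj₂ p × t ≤ toℕ (proj₁ p)
∈-completeEdges⁻ {suc m} {zero} p∈ with ∈-extend⁻ (allFin m) _ p∈
... | inj₁ (_ , _ , refl) = s≤s z≤n , z≤n
... | inj₂ (_ , q∈ , refl) = s≤s (proj₁ (∈-completeEdges⁻ q∈)) , z≤n
∈-completeEdges⁻ {suc m} {suc t} p∈ with ∈-map⁻ shift p∈
... | _ , q∈ , refl = Product.map s≤s s≤s (∈-completeEdges⁻ q∈)

∈-completeEdges⁺ : ∀ {m t} {i j : Fin m} → i <ᶠ j → t ≤ toℕ i → (i , j) ∈ completeEdges m t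
∈-completeEdges⁺ {suc m} {zero}  {zero}  {suc j} _ _ = ∈-extend⁺ˡ (allFin m) _ (∈-allFin j)
∈-completeEdges⁺ {suc m} {zero}  {suc i} {suc j} (s≤s i<j) _ =
  ∈-extend⁺ʳ (allFin m) _ (∈-completeEdges⁺ {t = zero} i<j z≤n)
∈-completeEdges⁺ {suc m} {suc t} {suc i} {suc j} (s≤s i<j) (s≤s t≤i) =
  ∈-map⁺ shift (∈-completeEdges⁺ i<j t≤i)

completeEdges-unique : ∀ m t → Unique (completeEdges m t)
completeEdges-unique zero    t       = []
completeEdges-unique (suc m) zero    =
  extend-unique (allFin m) _ (Unique.allFin⁺ m) (completeEdges-unique m zero)
completeEdges-unique (suc m) (suc t) = Unique.map⁺ (λ { refl → refl }) (completeEdges-unique m t)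

forwardDegree-completeEdges : ∀ m i → forwardDegree (completeEdges m zero) i ≤ m ∸ 1
forwardDegree-completeEdges (suc m) zero =
  ≤-reflexive (trans (forwardDegree-extend-zero (allFin m) _) (length-tabulate {n = m} (λ x → x)))
forwardDegree-completeEdges (suc m) (suc i) = begin
  forwardDegree (completeEdges (suc m) zero) (suc i) ≡⟨ forwardDegree-extend-suc (allFin m) _ i ⟩
  forwardDegree (completeEdges m zero) i             ≤⟨ forwardDegree-completeEdges m i ⟩
  m ∸ 1                                              ≤⟨ m∸n≤m m 1 ⟩
  m                                                  ∎
  where open ≤-Reasoning

module _ {d : ℕ} where

  DTree-size : ∀ {n} → DTree d n → suc d ≤ n
  DTree-size base          = ≤-refl
  DTree-size (add G _ _ _) = m≤n⇒m≤1+n (DTree-size G)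

  edgesFrom : ∀ {n} → DTree d n → ℕ → List (Edge n)
  edgesFrom base          t       = completeEdges (suc d) t
  edgesFrom (add G S _ _) zero    = extend S (edgesFrom G zero)
  edgesFrom (add G S _ _) (suc t) = map shift (edgesFrom G t)

  length-edgesFrom : ∀ {n} (G : DTree d n) t → length (edgesFrom G t) ≡ maxEdges d (n ∸ t)
  length-edgesFrom base t =
    trans (length-completeEdges (suc d) t) (sym (maxEdges-complete d _ (m∸n≤m (suc d) t)))
  length-edgesFrom {suc n} (add G S _ |S|≡d) zero = begin
    length (extend S (edgesFrom G zero))   ≡⟨ length-extend S _ ⟩
    length S + length (edgesFrom G zero)   ≡⟨ cong₂ _+_ |S|≡d (length-edgesFrom G zero) ⟩
    d + maxEdges d n                       ≡⟨ +-comm d _ ⟩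
    maxEdges d n + d                       ≡⟨ cong (maxEdges d n +_) (sym (m≥n⇒m⊓n≡n d≤n)) ⟩
    maxEdges d (suc n)                     ∎
    where
    open ≡-Reasoning
    d≤n = ≤-trans (n≤1+n d) (DTree-size G)
  length-edgesFrom (add G _ _ _) (suc t) = trans (length-map shift (edgesFrom G t)) (length-edgesFrom G t)

  ∈-edgesFrom⁻ : ∀ {n} (G : DTree d n) t {p} → p ∈ edgesFrom G t → IsEdge G p × t ≤ toℕ (proj₁ p)
  ∈-edgesFrom⁻ base t p∈ with ∈-completeEdges⁻ p∈
  ... | i<j , t≤i = (i<j , λ i≡j → <-irrefl (cong toℕ i≡j) i<j) , t≤i
  ∈-edgesFrom⁻ (add G S _ _) zero p∈ with ∈-extend⁻ S _ p∈
  ... | inj₁ (_ , s∈ , refl) = (s≤s z≤n , s∈) , z≤n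
  ... | inj₂ (_ , q∈ , refl) with ∈-edgesFrom⁻ G zero q∈
  ...   | (i<j , adj) , _ = (s≤s i<j , adj) , z≤n
  ∈-edgesFrom⁻ (add G S _ _) (suc t) p∈ with ∈-map⁻ shift p∈
  ... | _ , q∈ , refl with ∈-edgesFrom⁻ G t q∈
  ...   | (i<j , adj) , t≤i = (s≤s i<j , adj) , s≤s t≤i

  ∈-edgesFrom⁺ : ∀ {n} (G : DTree d n) t {i j} → IsEdge G (i , j) → t ≤ toℕ i → (i , j) ∈ edgesFrom G t
  ∈-edgesFrom⁺ base t (i<j , _) t≤i = ∈-completeEdges⁺ i<j t≤i
  ∈-edgesFrom⁺ (add G S _ _) zero    {zero}  {suc j} (_ , j∈S) _ = ∈-extend⁺ˡ S _ j∈S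
  ∈-edgesFrom⁺ (add G S _ _) zero    {suc i} {suc j} (s≤s i<j , adj) _ =
    ∈-extend⁺ʳ S _ (∈-edgesFrom⁺ G zero (i<j , adj) z≤n)
  ∈-edgesFrom⁺ (add G S _ _) (suc t) {suc i} {suc j} (s≤s i<j , adj) (s≤s t≤i) =
    ∈-map⁺ shift (∈-edgesFrom⁺ G t (i<j , adj) t≤i)

  edgesFrom-unique : ∀ {n} (G : DTree d n) t → Unique (edgesFrom G t)
  edgesFrom-unique base          t       = completeEdges-unique (suc d) t
  edgesFrom-unique (add G S u _) zero    = extend-unique S _ u (edgesFrom-unique G zero)
  edgesFrom-unique (add G _ _ _) (suc t) = Unique.map⁺ (λ { refl → refl }) (edgesFrom-unique G t)

  forwardDegree-edges : ∀ {n} (G : DTree d n) i → forwardDegree (edgesFrom G zero) i ≤ d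
  forwardDegree-edges base i = forwardDegree-completeEdges (suc d) i
  forwardDegree-edges (add G S _ |S|≡d) zero = ≤-reflexive (trans (forwardDegree-extend-zero S _) |S|≡d)
  forwardDegree-edges (add G S _ _) (suc i) =
    ≤-trans (≤-reflexive (forwardDegree-extend-suc S _ i)) (forwardDegree-edges G i)

  Adj-sym : ∀ {n} (G : DTree d n) {i j} → Adj G i j → Adj G j i
  Adj-sym base i≢j = λ j≡i → i≢j (sym j≡i)
  Adj-sym (add G S _ _) {zero}  {suc j} j∈S = j∈S
  Adj-sym (add G S _ _) {suc i} {zero}  i∈S = i∈S
  Adj-sym (add G S _ _) {suc i} {suc j} adj = Adj-sym G adj

  Adj-irrefl : ∀ {n} (G : DTree d n) {i} → ¬ Adj G i i
  Adj-irrefl base i≢i = i≢i refl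
  Adj-irrefl (add G S _ _) {suc i} adj = Adj-irrefl G adj

  Adj-connected : 1 ≤ d → ∀ {n} (G : DTree d n) u v → Star (Adj G) u v
  Adj-connected _ base u v with u ≟ᶠ v
  ... | yes refl = ε
  ... | no u≢v   = u≢v ◅ ε
  Adj-connected d≥1 (add G [] _ |S|≡d) _ _ = ⊥-elim (<-irrefl |S|≡d d≥1)
  Adj-connected d≥1 (add G (s ∷ S) _ _) zero    zero    = ε
  Adj-connected d≥1 (add G (s ∷ S) _ _) zero    (suc j) = here refl ◅ Star.gmap suc id (Adj-connected d≥1 G s j)
  Adj-connected d≥1 (add G (s ∷ S) _ _) (suc i) zero    = Star.gmap suc id (Adj-connected d≥1 G i s) ◅◅ (here refl ◅ ε)
  Adj-connected d≥1 (add G (s ∷ S) _ _) (suc i) (suc j) = Star.gmap suc id (Adj-connected d≥1 G i j)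

  all-edges-connected : 1 ≤ d → ∀ {n} (G : DTree d n) {L : List (Edge n)} → (∀ {p} → IsEdge G p → p ∈ L) →
    Connected L
  all-edges-connected d≥1 G {L} ⊇edges u v = (along ⋆) (Adj-connected d≥1 G u v)
    where
    along : ∀ {x y} → Adj G x y → Star (Step L) x y
    along {x} {y} adj with x Fin.<? y
    ... | yes x<y = inj₁ (⊇edges (x<y , adj)) ◅ ε
    ... | no x≮y  = inj₂ (⊇edges (y<x , Adj-sym G adj)) ◅ ε
      where
      y<x : y <ᶠ x
      y<x = ≤∧≢⇒< (≮⇒≥ x≮y) (λ y≡x → Adj-irrefl G (subst (Adj G x) (Fin.toℕ-injective y≡x) adj))

  many-edges⇒large-forest : ∀ {n} (G : DTree d n) {X : List (Edge n)} {k} →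
    Unique X → All (IsEdge G) X → maxEdges d k < length X → k ≤ length (kruskal X)
  many-edges⇒large-forest G {X} {k} u edges big = ≮⇒≥ λ small →
    <-irrefl refl (≤-trans big (≤-trans (length≤maxEdges d X u ordered degree) (maxEdges-mono d small)))
    where
    ordered : Ordered X
    ordered = All.map proj₁ edges
    degree : ∀ i → forwardDegree X i ≤ d
    degree i = ≤-trans
      (unique-⊆⇒length≤ (Unique.filter⁺ _ u) (λ p∈ → let p∈X , first≡i = ∈-filter⁻ _ {xs = X} p∈ in
         ∈-filter⁺ _ (∈-edgesFrom⁺ G zero (All.lookup edges p∈X) z≤n) first≡i))
      (forwardDegree-edges G i)

kruskal-spanning-tree : ∀ {d N} (G : DTree d (suc N)) {L} → All (IsEdge G) L → Connected L →
  IsSpanningTree G (kruskal L)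
kruskal-spanning-tree G {L} edges conn =
  All.tabulate (λ p∈ → All.lookup edges (kruskalFrom-⊆ _ L p∈)) ,
  kruskalFrom-unique _ L ,
  kruskal-connected conn ,
  connected-short⇒acyclic (kruskal-connected conn) (s≤s (≤-reflexive (length-kruskal-connected conn)))

-- A balanced spanning tree

-≢+ : Sign.- ≢ Sign.+
-≢+ ()

module _ {n : ℕ} (f : Colouring n) where

  colour : Edge n → Sign
  colour p = f (proj₁ p) (proj₂ p)

  coloured? : (σ : Sign) (p : Edge n) → Dec (colour p ≡ σ)
  coloured? σ p = colour p ≟ˢ σ

  #coloured : Sign → List (Edge n) → ℕ
  #coloured σ = count (coloured? σ)

  private
    #+ #- : List (Edge n) → ℕ
    #+ = #coloured Sign.+
    #- = #coloured Sign.-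

  weight≡⊖ : ∀ T → weight f T ≡ #coloured Sign.+ T ⊖ #coloured Sign.- T
  weight≡⊖ [] = refl
  weight≡⊖ (p ∷ T) with colour p | colour p ≟ˢ Sign.+ | colour p ≟ˢ Sign.-
  ... | Sign.+ | yes _ | no _  = trans (cong (ℤ._+_ ℤ.1ℤ) (weight≡⊖ T)) (distribʳ-⊖-+-pos 1 (#+ T) (#- T))
  ... | Sign.- | no _  | yes _ = trans (cong (ℤ._+_ ℤ.-1ℤ) (weight≡⊖ T)) (distribʳ-⊖-+-neg 0 (#+ T) (#- T))
  ... | Sign.+ | no ¬e | _     = ⊥-elim (¬e refl)
  ... | Sign.- | _     | no ¬e = ⊥-elim (¬e refl)
  ... | Sign.- | yes () | _

  length≡#coloured : ∀ T → length T ≡ #coloured Sign.+ T + #coloured Sign.- T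
  length≡#coloured [] = refl
  length≡#coloured (p ∷ T) with colour p | colour p ≟ˢ Sign.+ | colour p ≟ˢ Sign.-
  ... | Sign.+ | yes _ | no _  = cong suc (length≡#coloured T)
  ... | Sign.- | no _  | yes _ = trans (cong suc (length≡#coloured T)) (sym (+-suc _ _))
  ... | Sign.+ | no ¬e | _     = ⊥-elim (¬e refl)
  ... | Sign.- | _     | no ¬e = ⊥-elim (¬e refl)
  ... | Sign.- | yes () | _

∣⊖∣≤1 : ∀ {s t} → s + t ≤ 1 → ∣ s ⊖ t ∣ ≤ 1
∣⊖∣≤1 {0} {0} _ = z≤n
∣⊖∣≤1 {0} {1} _ = s≤s z≤n
∣⊖∣≤1 {1} {0} _ = s≤s z≤n
∣⊖∣≤1 {0} {suc (suc _)} (s≤s ())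
∣⊖∣≤1 {1} {suc _} (s≤s ())
∣⊖∣≤1 {suc (suc _)} {_} (s≤s ())

near-halves : ∀ {p m k r} → p + m ≡ r + (k + k) → r ≤ 1 → k ≤ p → k ≤ m → ∣ p ⊖ m ∣ ≤ 1
near-halves {p} {m} {k} {r} sum r≤1 k≤p k≤m = begin
  ∣ p ⊖ m ∣                         ≡⟨ cong₂ (λ a b → ∣ a ⊖ b ∣) (sym (m+[n∸m]≡n {k} {p} k≤p))
                                                                 (sym (m+[n∸m]≡n {k} {m} k≤m)) ⟩
  ∣ (k + (p ∸ k)) ⊖ (k + (m ∸ k)) ∣ ≡⟨ cong ∣_∣ (+-cancelˡ-⊖ k (p ∸ k) (m ∸ k)) ⟩
  ∣ (p ∸ k) ⊖ (m ∸ k) ∣             ≤⟨ ∣⊖∣≤1 {p ∸ k} {m ∸ k} (≤-trans (≤-reflexive excess) r≤1) ⟩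
  1                                 ∎
  where
  open ≤-Reasoning
  excess : (p ∸ k) + (m ∸ k) ≡ r
  excess = +-cancelʳ-≡ (k + k) _ _ (begin-equality
    (p ∸ k) + (m ∸ k) + (k + k)     ≡⟨ rearrange (p ∸ k) (m ∸ k) k ⟩
    ((p ∸ k) + k) + ((m ∸ k) + k)   ≡⟨ cong₂ _+_ (m∸n+n≡m k≤p) (m∸n+n≡m k≤m) ⟩
    p + m                           ≡⟨ sum ⟩
    r + (k + k)                     ∎)
    where
    rearrange : ∀ a b c → a + b + (c + c) ≡ (a + c) + (b + c)
    rearrange = solve-∀

module _ {E : Set} (φ : List E → ℕ) (φ-step : ∀ A e → φ A ≤ suc (φ (A ++ [ e ]))) where

  intermediate-prefix : ∀ {lo hi} M → lo ≤ hi → lo ≤ φ [] → φ M ≤ hi →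
    ∃ λ A → ∃ λ B → A ++ B ≡ M × lo ≤ φ A × φ A ≤ hi
  intermediate-prefix {lo} {hi} M lo≤hi = search [] M
    where
    search : ∀ A B → lo ≤ φ A → φ (A ++ B) ≤ hi →
      ∃ λ A′ → ∃ λ B′ → A′ ++ B′ ≡ A ++ B × lo ≤ φ A′ × φ A′ ≤ hi
    search A B lo≤ ≤hi with φ A ≤? hi
    ... | yes φA≤hi = A , B , refl , lo≤ , φA≤hi
    search A [] lo≤ ≤hi | no φA≰hi = ⊥-elim (φA≰hi (subst (λ L → φ L ≤ hi) (++-identityʳ A) ≤hi))
    search A (e ∷ B) lo≤ ≤hi | no φA≰hi
      with search (A ++ [ e ]) B lo≤next (subst (λ L → φ L ≤ hi) (sym (++-assoc A [ e ] B)) ≤hi)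
      where
      lo≤next : lo ≤ φ (A ++ [ e ])
      lo≤next = ≤-trans lo≤hi (≤-pred (≤-trans (≰⇒> φA≰hi) (φ-step A e)))
    ... | A′ , B′ , eq , found = A′ , B′ , trans eq (++-assoc A [ e ] B) , found

allPairs-complete : ∀ {n} (p : Edge n) → p ∈ allPairs n
allPairs-complete (i , j) = ∈-cartesianProduct⁺ (∈-allFin i) (∈-allFin j)

allPairs-unique : ∀ n → Unique (allPairs n)
allPairs-unique n = Unique.cartesianProduct⁺ (Unique.allFin⁺ n) (Unique.allFin⁺ n)

module _ {d n : ℕ} (G : DTree d n) (f : Colouring n) where

  inColourClass? : (σ : Sign) (p : Edge n) → Dec (IsEdge G p × colour f p ≡ σ)
  inColourClass? σ p = isEdge? G p ×-dec coloured? f σ p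

  colourClass : Sign → List (Edge n)
  colourClass σ = filter (inColourClass? σ) (allPairs n)

  ∈-colourClass⁻ : ∀ {σ p} → p ∈ colourClass σ → IsEdge G p × colour f p ≡ σ
  ∈-colourClass⁻ {σ} p∈ = proj₂ (∈-filter⁻ (inColourClass? σ) {xs = allPairs n} p∈)

  ∈-colourClass⁺ : ∀ {σ p} → IsEdge G p → colour f p ≡ σ → p ∈ colourClass σ
  ∈-colourClass⁺ {σ} {p} edge coloured = ∈-filter⁺ (inColourClass? σ) (allPairs-complete p) (edge , coloured)

module _ {d N : ℕ} (G : DTree d (suc N)) (f : Colouring (suc N)) where

  colourClass-forest : ∀ {σ k} → maxEdges d k < e G f σ → k ≤ length (kruskal (colourClass G f σ))
  colourClass-forest {σ} = many-edges⇒large-forest G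
    (Unique.filter⁺ (inColourClass? G f σ) (allPairs-unique (suc N)))
    (All.tabulate (λ p∈ → proj₁ (∈-colourClass⁻ G f p∈)))

  M P : List (Edge (suc N))
  M = colourClass G f Sign.-
  P = colourClass G f Sign.+

  plusAfter : List (Edge (suc N)) → ℕ
  plusAfter A = length (kruskalFrom (label A) P)

  module _ {A B : List (Edge (suc N))} (A++B≡M : A ++ B ≡ M) where

    minus-edge : ∀ {p} → p ∈ A ⊎ p ∈ B → IsEdge G p × colour f p ≡ Sign.-
    minus-edge (inj₁ p∈A) = ∈-colourClass⁻ G f (subst (_ ∈_) A++B≡M (∈-++⁺ˡ p∈A))
    minus-edge (inj₂ p∈B) = ∈-colourClass⁻ G f (subst (_ ∈_) A++B≡M (∈-++⁺ʳ A p∈B))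

    split-edges : All (IsEdge G) (A ++ P ++ B)
    split-edges = All.tabulate λ p∈ → case ∈-++⁻ A p∈ of λ where
      (inj₁ p∈A) → proj₁ (minus-edge (inj₁ p∈A))
      (inj₂ p∈PB) → case ∈-++⁻ P p∈PB of λ where
        (inj₁ p∈P) → proj₁ (∈-colourClass⁻ G f p∈P)
        (inj₂ p∈B) → proj₁ (minus-edge (inj₂ p∈B))

    split-connected : 1 ≤ d → Connected (A ++ P ++ B)
    split-connected d≥1 = all-edges-connected d≥1 G covers
      where
      covers : ∀ {p} → IsEdge G p → p ∈ A ++ P ++ B
      covers {p} edge with colour f p in coloured
      ... | Sign.+ = ∈-++⁺ʳ A (∈-++⁺ˡ (∈-colourClass⁺ G f edge coloured))
      ... | Sign.- with ∈-++⁻ A (subst (_ ∈_) (sym A++B≡M) (∈-colourClass⁺ G f edge coloured))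
      ...   | inj₁ p∈A = ∈-++⁺ˡ p∈A
      ...   | inj₂ p∈B = ∈-++⁺ʳ A (∈-++⁺ʳ P p∈B)

    #plus-split-kruskal : #coloured f Sign.+ (kruskal (A ++ P ++ B)) ≡ plusAfter A
    #plus-split-kruskal = begin
      #coloured f Sign.+ (kruskal (A ++ P ++ B))
        ≡⟨ cong (#coloured f Sign.+) (trans (kruskalFrom-++ _ A (P ++ B))
                                            (cong (kruskal A ++_) (kruskalFrom-++ (label A) P B))) ⟩
      #coloured f Sign.+ (kruskal A ++ kruskalFrom (label A) P ++ kruskalFrom (mergeAll (label A) P) B)
        ≡⟨ trans (count-++ plus? (kruskal A) _)
                 (cong (#coloured f Sign.+ (kruskal A) +_) (count-++ plus? (kruskalFrom (label A) P) _)) ⟩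
      #coloured f Sign.+ (kruskal A) + (#coloured f Sign.+ (kruskalFrom (label A) P)
                                       + #coloured f Sign.+ (kruskalFrom (mergeAll (label A) P) B))
        ≡⟨ cong₂ _+_ (none (λ p∈ → inj₁ (kruskalFrom-⊆ _ A p∈)))
                     (cong₂ _+_ (count-all plus? (All.tabulate (λ p∈ → proj₂ (plus-edge (kruskalFrom-⊆ _ P p∈)))))
                                (none (λ p∈ → inj₂ (kruskalFrom-⊆ _ B p∈)))) ⟩
      0 + (plusAfter A + 0)
        ≡⟨ +-identityʳ _ ⟩
      plusAfter A ∎
      where
      open ≡-Reasoning
      plus? = coloured? f Sign.+
      plus-edge = ∈-colourClass⁻ G f
      none : ∀ {T} → (∀ {p} → p ∈ T → p ∈ A ⊎ p ∈ B) → #coloured f Sign.+ T ≡ 0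
      none T⊆ = count-none plus? (All.tabulate λ p∈ plus → -≢+ (trans (sym (proj₂ (minus-edge (T⊆ p∈)))) plus))

    split-good-tree : 1 ≤ d → ∀ {k r} → N ≡ r + (k + k) → r ≤ 1 →
      k ≤ plusAfter A → plusAfter A + k ≤ N → HasGoodTree G f
    split-good-tree d≥1 {k} {r} N≡ r≤1 k≤plus plus+k≤N =
      T , kruskal-spanning-tree G split-edges connected , balanced
      where
      connected = split-connected d≥1
      T = kruskal (A ++ P ++ B)
      sum : #coloured f Sign.+ T + #coloured f Sign.- T ≡ r + (k + k)
      sum = trans (sym (length≡#coloured f T)) (trans (length-kruskal-connected connected) N≡)
      k≤#plus : k ≤ #coloured f Sign.+ T
      k≤#plus = subst (k ≤_) (sym #plus-split-kruskal) k≤plus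
      k≤#minus : k ≤ #coloured f Sign.- T
      k≤#minus = +-cancelˡ-≤ (#coloured f Sign.+ T) _ _ (begin
        #coloured f Sign.+ T + k                    ≡⟨ cong (_+ k) #plus-split-kruskal ⟩
        plusAfter A + k                             ≤⟨ plus+k≤N ⟩
        N                                           ≡⟨ sym (length-kruskal-connected connected) ⟩
        length T                                    ≡⟨ length≡#coloured f T ⟩
        #coloured f Sign.+ T + #coloured f Sign.- T ∎)
        where open ≤-Reasoning
      balanced : ∣ weight f T ∣ ≤ 1
      balanced = subst (λ w → ∣ w ∣ ≤ 1) (sym (weight≡⊖ f T)) (near-halves sum r≤1 k≤#plus k≤#minus)

  forest+plusAfter : 1 ≤ d → length (kruskal M) + plusAfter M ≡ N
  forest+plusAfter d≥1 = begin
    length (kruskal M) + plusAfter M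
      ≡⟨ cong (λ L → length (kruskal M) + length (kruskalFrom (label M) L)) (sym (++-identityʳ P)) ⟩
    length (kruskal M) + length (kruskalFrom (label M) (P ++ []))
      ≡⟨ sym (length-kruskal-++ M (P ++ [])) ⟩
    length (kruskal (M ++ P ++ []))
      ≡⟨ length-kruskal-connected (split-connected {A = M} {B = []} (++-identityʳ M) d≥1) ⟩
    N ∎
    where open ≡-Reasoning

  good-tree-exists : 1 ≤ d → ∀ {k r} → N ≡ r + (k + k) → r ≤ 1 →
    maxEdges d k < e G f Sign.- → maxEdges d k < e G f Sign.+ → HasGoodTree G f
  good-tree-exists d≥1 {k} {r} N≡ r≤1 many-minus many-plus =
    let A , B , A++B≡M , k≤plus , plus≤N∸k =
          intermediate-prefix plusAfter (λ A e → length-kruskalFrom-snoc A e P)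
                              M k≤N∸k (colourClass-forest many-plus) plusAfter-M≤
    in split-good-tree {A = A} {B = B} A++B≡M d≥1 N≡ r≤1 k≤plus
         (m≤o∸n⇒m+n≤o (plusAfter A) (≤-trans k≤N∸k (m∸n≤m N k)) plus≤N∸k)
    where
    k≤N∸k : k ≤ N ∸ k
    k≤N∸k = m+n≤o⇒m≤o∸n k (≤-trans (m≤n+m (k + k) r) (≤-reflexive (sym N≡)))
    plusAfter-M≤ : plusAfter M ≤ N ∸ k
    plusAfter-M≤ = m+n≤o⇒m≤o∸n (plusAfter M) (begin
      plusAfter M + k                   ≤⟨ +-monoʳ-≤ (plusAfter M) (colourClass-forest many-minus) ⟩
      plusAfter M + length (kruskal M)  ≡⟨ +-comm (plusAfter M) _ ⟩
      length (kruskal M) + plusAfter M  ≡⟨ forest+plusAfter d≥1 ⟩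
      N                                 ∎)
      where open ≤-Reasoning

count-allPairs : ∀ {n} {P : Edge n → Set} (P? : Decidable P) {ys : List (Edge n)} → Unique ys →
  (∀ {p} → p ∈ ys → P p) → (∀ {p} → P p → p ∈ ys) → count P? (allPairs n) ≡ length ys
count-allPairs {n} P? u ys⇒P P⇒ys = ≤-antisym
  (unique-⊆⇒length≤ (Unique.filter⁺ P? (allPairs-unique n))
                    (λ p∈ → P⇒ys (proj₂ (∈-filter⁻ P? {xs = allPairs n} p∈))))
  (unique-⊆⇒length≤ u (λ {p} p∈ → ∈-filter⁺ P? (allPairs-complete p) (ys⇒P p∈)))

-- Sharpness

-- Labels grow with age in a DTree, so this colours −1 exactly the edges among the n ∸ t oldest vertices.
oldColouring : ∀ {n} → ℕ → Colouring n
oldColouring t i j with (t ≤? toℕ i) ×-dec (t ≤? toℕ j)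
... | yes _ = Sign.-
... | no _  = Sign.+

oldColouring-minus⁻ : ∀ {n t} {i j : Fin n} → oldColouring t i j ≡ Sign.- → t ≤ toℕ i × t ≤ toℕ j
oldColouring-minus⁻ {t = t} {i} {j} minus with (t ≤? toℕ i) ×-dec (t ≤? toℕ j)
oldColouring-minus⁻ _     | yes old = old
oldColouring-minus⁻ ()    | no _

oldColouring-minus⁺ : ∀ {n t} {i j : Fin n} → t ≤ toℕ i → t ≤ toℕ j → oldColouring t i j ≡ Sign.-
oldColouring-minus⁺ {t = t} {i} {j} t≤i t≤j with (t ≤? toℕ i) ×-dec (t ≤? toℕ j)
... | yes _  = refl
... | no new = ⊥-elim (new (t≤i , t≤j))

module _ (d : ℕ) where

  maxEdges≤ : ∀ s → maxEdges d s ≤ s * d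
  maxEdges≤ zero    = z≤n
  maxEdges≤ (suc s) = ≤-trans (+-mono-≤ (maxEdges≤ s) (m⊓n≤n s d)) (≤-reflexive (+-comm (s * d) d))

  maxEdges-double : ∀ {k s} → d ≤ k → k + k ≤ s → maxEdges d k + maxEdges d k ≤ maxEdges d s
  maxEdges-double {k} {s} d≤k k+k≤s = begin
    maxEdges d k + maxEdges d k       ≤⟨ +-monoʳ-≤ (maxEdges d k) (≤-trans (maxEdges≤ k) (*-monoˡ-≤ d k≤s∸k)) ⟩
    maxEdges d k + (s ∸ k) * d        ≡⟨ cong (λ m → maxEdges d k + (s ∸ k) * m) (sym (m≥n⇒m⊓n≡n d≤k)) ⟩
    maxEdges d k + (s ∸ k) * (k ⊓ d)  ≤⟨ maxEdges-+ d k (s ∸ k) ⟩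
    maxEdges d (k + (s ∸ k))          ≡⟨ cong (maxEdges d) (m+[n∸m]≡n (≤-trans (m≤m+n k k) k+k≤s)) ⟩
    maxEdges d s                      ∎
    where
    open ≤-Reasoning
    k≤s∸k : k ≤ s ∸ k
    k≤s∸k = m+n≤o⇒m≤o∸n k k+k≤s

module _ {d n : ℕ} (G : DTree d n) where

  #edges : ∀ f → e G f Sign.- + e G f Sign.+ ≡ maxEdges d n
  #edges f = begin
    e G f Sign.- + e G f Sign.+
      ≡⟨ cong (e G f Sign.- +_) (count-cong (inColourClass? G f Sign.+) not-minus?
                                            (Product.map₂ λ plus minus → -≢+ (trans (sym minus) plus))
                                            (Product.map₂ not-minus) (allPairs n)) ⟩
    count (inColourClass? G f Sign.-) (allPairs n) + count not-minus? (allPairs n)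
      ≡⟨ sym (count-split (isEdge? G) (coloured? f Sign.-) (allPairs n)) ⟩
    count (isEdge? G) (allPairs n)
      ≡⟨ count-allPairs (isEdge? G) (edgesFrom-unique G zero)
           (λ p∈ → proj₁ (∈-edgesFrom⁻ G zero p∈)) (λ edge → ∈-edgesFrom⁺ G zero edge z≤n) ⟩
    length (edgesFrom G zero)
      ≡⟨ length-edgesFrom G zero ⟩
    maxEdges d n ∎
    where
    open ≡-Reasoning
    not-minus? = λ p → isEdge? G p ×-dec ¬? (coloured? f Sign.- p)
    not-minus : ∀ {σ} → σ ≢ Sign.- → σ ≡ Sign.+
    not-minus {Sign.-} σ≢- = ⊥-elim (σ≢- refl)
    not-minus {Sign.+} _   = refl

  e-oldColouring : ∀ t → e G (oldColouring t) Sign.- ≡ maxEdges d (n ∸ t)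
  e-oldColouring t = trans
    (count-allPairs (inColourClass? G (oldColouring t) Sign.-) (edgesFrom-unique G t) old-edge
       (λ (edge , minus) → ∈-edgesFrom⁺ G t edge (proj₁ (oldColouring-minus⁻ minus))))
    (length-edgesFrom G t)
    where
    old-edge : ∀ {p} → p ∈ edgesFrom G t → IsEdge G p × colour (oldColouring t) p ≡ Sign.-
    old-edge p∈ with ∈-edgesFrom⁻ G t p∈
    ... | (i<j , adj) , t≤i = (i<j , adj) , oldColouring-minus⁺ t≤i (≤-trans t≤i (<⇒≤ i<j))

far-apart : ∀ {p m k} → k + k ≤ p + m → suc m ≤ k → 2 ≤ ∣ p ⊖ m ∣
far-apart {p} {m} {k} big small = subst (2 ≤_) (sym (cong ∣_∣ (⊖-≥ (≤-trans (m≤n+m m 2) m+2≤p))))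
                                         (m+n≤o⇒m≤o∸n 2 m+2≤p)
  where
  m+2≤p : 2 + m ≤ p
  m+2≤p = +-cancelʳ-≤ m (2 + m) p (begin
    2 + m + m         ≡⟨ cong suc (sym (+-suc m m)) ⟩
    suc m + suc m     ≤⟨ +-mono-≤ small small ⟩
    k + k             ≤⟨ big ⟩
    p + m             ∎)
    where open ≤-Reasoning

module _ {d N : ℕ} (G : DTree d (suc N)) where

  minus-forest : ∀ {t T} → t < suc N → IsSpanningTree G T →
    #coloured (oldColouring t) Sign.- T + suc t ≤ suc N
  minus-forest {t} {T} t<n (edges , unique , _ , acyclic) = begin
    length Tm + suc t           ≤⟨ +-monoʳ-≤ (length Tm) (isolated-prefix⇒#components late t<n) ⟩
    length Tm + #components Tm  ≡⟨ +-comm (length Tm) _ ⟩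
    #components Tm + length Tm  ≡⟨ cong (λ L → #components Tm + length L) (sym keeps) ⟩
    #components Tm + length (kruskal Tm) ≡⟨ #components+length-kruskal Tm ⟩
    suc N                       ∎
    where
    open ≤-Reasoning
    minus? = coloured? (oldColouring t) Sign.-
    Tm = filter minus? T
    Tm⊆T : Tm ⊆ T
    Tm⊆T p∈ = proj₁ (∈-filter⁻ minus? {xs = T} p∈)
    old : ∀ {p} → p ∈ Tm → t ≤ toℕ (proj₁ p) × t ≤ toℕ (proj₂ p)
    old p∈ = oldColouring-minus⁻ (proj₂ (∈-filter⁻ minus? {xs = T} p∈))
    late : ∀ {x y} → Step Tm x y → t ≤ toℕ x
    late (inj₁ p∈) = proj₁ (old p∈)
    late (inj₂ p∈) = proj₂ (old p∈)
    keeps : kruskal Tm ≡ Tm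
    keeps = acyclic⇒kruskal-keeps (Unique.filter⁺ minus? unique)
              (All.tabulate (λ p∈ → proj₁ (All.lookup edges (Tm⊆T p∈))))
              (λ cycle → acyclic (Cycle-mono Tm⊆T cycle))

  no-good-tree : ∀ {k} → k + k ≤ N → 1 ≤ k → ¬ HasGoodTree G (oldColouring (suc N ∸ k))
  no-good-tree {k} k+k≤N k≥1 (T , spanning , balanced) =
    <-irrefl refl (≤-trans (far-apart many few) (subst (λ w → ∣ w ∣ ≤ 1) (weight≡⊖ f T) balanced))
    where
    open ≤-Reasoning
    f = oldColouring (suc N ∸ k)
    k≤n : k ≤ suc N
    k≤n = ≤-trans (m≤m+n k k) (≤-trans k+k≤N (n≤1+n N))
    many : k + k ≤ #coloured f Sign.+ T + #coloured f Sign.- T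
    many = begin
      k + k      ≤⟨ k+k≤N ⟩
      N          ≤⟨ ≤-pred (connected⇒length≥ (proj₁ (proj₂ (proj₂ spanning)))) ⟩
      length T   ≡⟨ length≡#coloured f T ⟩
      #coloured f Sign.+ T + #coloured f Sign.- T ∎
    few : suc (#coloured f Sign.- T) ≤ k
    few = +-cancelʳ-≤ (suc N ∸ k) _ _ (begin
      suc (#coloured f Sign.- T) + (suc N ∸ k) ≡⟨ sym (+-suc _ _) ⟩
      #coloured f Sign.- T + suc (suc N ∸ k)   ≤⟨ minus-forest (∸-monoʳ-< {suc N} {k} {0} k≥1 k≤n) spanning ⟩
      suc N                                    ≡⟨ sym (m+[n∸m]≡n k≤n) ⟩
      k + (suc N ∸ k)                          ∎)

  minCol-oldColouring : ∀ {k} → d ≤ k → k + k ≤ suc N →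
    minCol G (oldColouring (suc N ∸ k)) ≡ maxEdges d k
  minCol-oldColouring {k} d≤k k+k≤n = trans (cong (_⊓ e G f Sign.+) minus) (m≤n⇒m⊓n≡m few-minus)
    where
    f = oldColouring (suc N ∸ k)
    minus : e G f Sign.- ≡ maxEdges d k
    minus = trans (e-oldColouring G (suc N ∸ k))
                  (cong (maxEdges d) (m∸[m∸n]≡n (≤-trans (m≤m+n k k) k+k≤n)))
    few-minus : maxEdges d k ≤ e G f Sign.+
    few-minus = +-cancelˡ-≤ (maxEdges d k) _ _ (begin
      maxEdges d k + maxEdges d k   ≤⟨ maxEdges-double d d≤k k+k≤n ⟩
      maxEdges d (suc N)            ≡⟨ sym (#edges G f) ⟩
      e G f Sign.- + e G f Sign.+   ≡⟨ cong (_+ e G f Sign.+) minus ⟩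
      maxEdges d k + e G f Sign.+   ∎)
      where open ≤-Reasoning

module _ (d : ℕ) where

  maxEdges-linear : ∀ t → maxEdges d (d + t) ≡ maxEdges d d + t * d
  maxEdges-linear zero    = trans (cong (maxEdges d) (+-identityʳ d)) (sym (+-identityʳ _))
  maxEdges-linear (suc t) = begin
    maxEdges d (d + suc t)                 ≡⟨ cong (maxEdges d) (+-suc d t) ⟩
    maxEdges d (d + t) + (d + t) ⊓ d       ≡⟨ cong₂ _+_ (maxEdges-linear t) (m≥n⇒m⊓n≡n (m≤m+n d t)) ⟩
    maxEdges d d + t * d + d               ≡⟨ +-assoc (maxEdges d d) (t * d) d ⟩
    maxEdges d d + (t * d + d)             ≡⟨ cong (maxEdges d d +_) (+-comm (t * d) d) ⟩
    maxEdges d d + suc t * d               ∎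
    where open ≡-Reasoning

  maxEdges≡bound : ∀ {k} → d ≤ k → maxEdges d k ≡ k * d ∸ suc d C 2
  maxEdges≡bound {k} d≤k = sym (trans (cong (_∸ suc d C 2) (sym sum)) (m+n∸n≡m (maxEdges d k) (suc d C 2)))
    where
    open ≡-Reasoning
    t = k ∸ d
    sum : maxEdges d k + suc d C 2 ≡ k * d
    sum = begin
      maxEdges d k + suc d C 2          ≡⟨ cong (λ s → maxEdges d s + suc d C 2) (sym (m+[n∸m]≡n d≤k)) ⟩
      maxEdges d (d + t) + suc d C 2    ≡⟨ cong₂ _+_ (maxEdges-linear t) (C2-suc d) ⟩
      maxEdges d d + t * d + (d + d C 2) ≡⟨ cong (λ c → c + t * d + (d + d C 2)) (maxEdges-complete d d (n≤1+n d)) ⟩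
      d C 2 + t * d + (d + d C 2)       ≡⟨ rearrange (d C 2) (t * d) d ⟩
      d C 2 + d C 2 + d + t * d         ≡⟨ cong (_+ t * d) (C2-double d) ⟩
      d * d + t * d                     ≡⟨ sym (*-distribʳ-+ d d t) ⟩
      (d + t) * d                       ≡⟨ cong (_* d) (m+[n∸m]≡n d≤k) ⟩
      k * d                             ∎
      where
      rearrange : ∀ c x d → c + x + (d + c) ≡ c + c + d + x
      rearrange = solve-∀

halve : ∀ N → N ≡ N % 2 + (N / 2 + N / 2)
halve N = trans (m≡m%n+[m/n]*n N 2) (cong (N % 2 +_) twice)
  where
  twice : N / 2 * 2 ≡ N / 2 + N / 2
  twice = trans (*-comm (N / 2) 2) (cong (N / 2 +_) (+-identityʳ (N / 2)))

large-half : ∀ {d N k r} → 2 * d + 2 ≤ suc N → N ≡ r + (k + k) → r ≤ 1 → d ≤ k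
large-half {d} {N} {k} {r} n≥ N≡ r≤1 = ≮⇒≥ λ k<d → <-irrefl refl (≤-trans (+-mono-< k<d k<d) d+d≤k+k)
  where
  open ≤-Reasoning
  d+d≤k+k : d + d ≤ k + k
  d+d≤k+k = +-cancelˡ-≤ 1 _ _ (≤-pred (begin
    suc (1 + (d + d))  ≡⟨ cong (λ x → 2 + (d + x)) (sym (+-identityʳ d)) ⟩
    2 + 2 * d          ≡⟨ +-comm 2 (2 * d) ⟩
    2 * d + 2          ≤⟨ n≥ ⟩
    suc N              ≡⟨ cong suc N≡ ⟩
    suc (r + (k + k))  ≤⟨ s≤s (+-monoˡ-≤ (k + k) r≤1) ⟩
    suc (1 + (k + k))  ∎))

theorem5p4 : (d n : ℕ) (G : DTree d n) → 1 ≤ d → 2 * d + 2 ≤ n →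
    ((f : Colouring n) → bound d n < minCol G f → HasGoodTree G f)
    × (Σ (Colouring n) λ f → (minCol G f ≡ bound d n) × ¬ HasGoodTree G f)
theorem5p4 d zero    G d≥1 n≥ with () ← ≤-trans (m≤n+m 2 (2 * d)) n≥
theorem5p4 d (suc N) G d≥1 n≥ =
  (λ f beats → good-tree-exists G f d≥1 {k} {r} N≡ r≤1 (beats-class f beats (m⊓n≤m _ _))
                                                      (beats-class f beats (m⊓n≤n _ _))) ,
  oldColouring (suc N ∸ k) ,
  trans (minCol-oldColouring G d≤k (≤-trans k+k≤N (n≤1+n N))) bound≡ ,
  no-good-tree G k+k≤N (≤-trans d≥1 d≤k)
  where
  k = N / 2
  r = N % 2
  N≡ : N ≡ r + (k + k)
  N≡ = halve N
  r≤1 : r ≤ 1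
  r≤1 = ≤-pred (m%n<n N 2)
  k+k≤N : k + k ≤ N
  k+k≤N = ≤-trans (m≤n+m (k + k) r) (≤-reflexive (sym N≡))
  d≤k : d ≤ k
  d≤k = large-half n≥ N≡ r≤1
  bound≡ : maxEdges d k ≡ bound d (suc N)
  bound≡ = maxEdges≡bound d d≤k
  beats-class : ∀ f → bound d (suc N) < minCol G f → ∀ {σ} → minCol G f ≤ e G f σ → maxEdges d k < e G f σ
  beats-class f beats min≤ = ≤-trans (s≤s (≤-reflexive bound≡)) (≤-trans beats min≤)
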